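{- Let $S\subseteq\mathbb{Z}$ be a finite set with $|S|\ge 3$ and let $s_0\in S$. The following are equivalent: (i) there is a finite AP-free colouring of $\mathbb{N}$ that contains no almost-monochromatic positive homothetic copy of $(S,s_0)$ (contained in $\mathbb{N}$); (ii) there is a finite AP-free colouring of $\mathbb{R}$ that contains no almost-monochromatic positive homothetic copy of $(S,s_0)$; (iii) $|S|>3$ and $s_0$ is not an extreme point of $S$ (i.e. $s_0\neq\min S$ and $s_0\neq\max S$).
   Context: A colouring is finite if it uses finitely many colours. An infinite arithmetic progression is a set $\{a+mt: m\in\mathbb{N}\}$ with $t\neq 0$; a colouring is AP-free if it contains no monochromatic infinite arithmetic progression. A positive homothetic copy of $(S,s_0)$ is $(c+\lambda S,c+\lambda s_0)$ with $c\in\mathbb{R}$, $\lambda>0$. A pair $(T,t_0)$ with $t_0\in T$ is almost-monochromatic if $T\setminus\{t_0\}$ is monochromatic but $T$ is not. -}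

module Defs where

open import Level using (0ℓ)
open import Data.Nat as ℕ using (ℕ; zero; suc)
open import Data.Integer as ℤ using (ℤ; +_; -[1+_])
open import Data.Fin using (Fin)
open import Data.List using (List; length)
open import Data.List.Membership.Propositional using (_∈_)
open import Data.Product using (Σ; ∃; _×_; _,_)
open import Data.Sum using (_⊎_)
open import Relation.Nullary using (¬_)
open import Relation.Binary.PropositionalEquality using (_≡_; _≢_)
open import Relation.Binary.Core using (Rel)
open import Relation.Binary.Structures using (IsStrictTotalOrder)
open import Algebra.Structures using (IsCommutativeRing)

-- A (Dedekind-)complete ordered field, i.e. an axiomatisation of ℝ
-- (all models are isomorphic to ℝ).  Equality is propositional.
record CompleteOrderedField : Set₁ where
  infixl 6 _+_
  infixl 7 _*_
  infix 4 _<_ _≤_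
  field
    Carrier : Set
    _+_ _*_ : Carrier → Carrier → Carrier
    -_      : Carrier → Carrier
    0# 1#   : Carrier
    isCommutativeRing : IsCommutativeRing _≡_ _+_ _*_ -_ 0# 1#
    0≢1     : 0# ≢ 1#
    inverse : ∀ x → x ≢ 0# → ∃ λ y → x * y ≡ 1#
    _<_     : Rel Carrier 0ℓ
    <-isStrictTotalOrder : IsStrictTotalOrder _≡_ _<_
    +-monoˡ-< : ∀ {x y} z → x < y → x + z < y + z
    *-pos   : ∀ {x y} → 0# < x → 0# < y → 0# < x * y

  _≤_ : Carrier → Carrier → Set
  x ≤ y = x < y ⊎ x ≡ y

  field
    sup : (P : Carrier → Set) → (∃ λ x → P x) →
          (∃ λ b → ∀ x → P x → x ≤ b) →
          ∃ λ s → (∀ x → P x → x ≤ s) × (∀ b → (∀ x → P x → x ≤ b) → s ≤ b)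

module _ (R : CompleteOrderedField) where
  open CompleteOrderedField R

  fromℕ : ℕ → Carrier
  fromℕ zero    = 0#
  fromℕ (suc n) = 1# + fromℕ n

  fromℤ : ℤ → Carrier
  fromℤ (+ n)      = fromℕ n
  fromℤ -[1+ n ]   = - fromℕ (suc n)

-- (T, t0) with T = g(S), g injective on S: T∖{t0} monochromatic, T not.
AlmostMonochromatic : {k : ℕ} → (ℤ → Fin k) → List ℤ → ℤ → Set
AlmostMonochromatic g S s₀ =
  (∀ s s' → s ∈ S → s' ∈ S → s ≢ s₀ → s' ≢ s₀ → g s ≡ g s') ×
  ¬ (∀ s s' → s ∈ S → s' ∈ S → g s ≡ g s')

-- colourings of ℕ --------------------------------------------------------
-- An infinite AP {a + m t : m ∈ ℕ} contained in ℕ has a ∈ ℕ, t ∈ ℕ, t ≠ 0.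
APFreeℕ : {k : ℕ} → (ℕ → Fin k) → Set
APFreeℕ χ = ¬ (Σ ℕ λ a → Σ ℕ λ t → t ≢ 0 × (∀ m → χ (a ℕ.+ m ℕ.* t) ≡ χ a))

HasAMCopyℕ : (R : CompleteOrderedField) → {k : ℕ} → (ℕ → Fin k) → List ℤ → ℤ → Set
HasAMCopyℕ R χ S s₀ =
  Σ Carrier λ c → Σ Carrier λ lam → 0# < lam ×
  Σ (ℤ → ℕ) λ f → (∀ s → s ∈ S → fromℕ R (f s) ≡ c + lam * fromℤ R s) ×
  AlmostMonochromatic (λ s → χ (f s)) S s₀
  where open CompleteOrderedField R

APFreeℝ : (R : CompleteOrderedField) → {k : ℕ} → (CompleteOrderedField.Carrier R → Fin k) → Set
APFreeℝ R χ = ¬ (Σ Carrier λ a → Σ Carrier λ t → t ≢ 0# ×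
                  (∀ m → χ (a + fromℕ R m * t) ≡ χ a))
  where open CompleteOrderedField R

HasAMCopyℝ : (R : CompleteOrderedField) → {k : ℕ} → (CompleteOrderedField.Carrier R → Fin k) →
             List ℤ → ℤ → Set
HasAMCopyℝ R χ S s₀ =
  Σ Carrier λ c → Σ Carrier λ lam → 0# < lam ×
  AlmostMonochromatic (λ s → χ (c + lam * fromℤ R s)) S s₀
  where open CompleteOrderedField R

Cond-i : CompleteOrderedField → List ℤ → ℤ → Set
Cond-i R S s₀ = Σ ℕ λ k → Σ (ℕ → Fin k) λ χ → APFreeℕ χ × ¬ HasAMCopyℕ R χ S s₀

Cond-ii : CompleteOrderedField → List ℤ → ℤ → Set
Cond-ii R S s₀ = Σ ℕ λ k → Σ (CompleteOrderedField.Carrier R → Fin k) λ χ →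
                 APFreeℝ R χ × ¬ HasAMCopyℝ R χ S s₀

IsMinOf : ℤ → List ℤ → Set
IsMinOf x S = x ∈ S × (∀ s → s ∈ S → x ℤ.≤ s)

IsMaxOf : ℤ → List ℤ → Set
IsMaxOf x S = x ∈ S × (∀ s → s ∈ S → s ℤ.≤ x)

Cond-iii : List ℤ → ℤ → Set
Cond-iii S s₀ = 3 ℕ.< length S × ¬ IsMinOf s₀ S × ¬ IsMaxOf s₀ S

{-# OPTIONS --safe #-}
module Submission where

-- From (i) to (iii): van der Waerden gives a monochromatic progression, say of colour c and difference d.
-- If s₀ = max S, it extends to the right for ever. If s₀ = min S, it extends to the left down to the
-- start of ℕ; as d is bounded, some residue class is then monochromatic on arbitrarily long initial
-- segments, hence entirely. If S has three points with s₀ in the middle, at distances p and q from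
-- the others, then a common colour of x and x + (p+q)d is also that of x + pd. Take a monochromatic
-- progression of length p + q: if the next term z does not have colour c, then neither does any
-- z + tqd, and this progression is coloured with one colour fewer.
--
-- From (iii) to (ii): colour x by its sign and by ⌊log_q |x|⌋ modulo K, with q close to 1 and K large.
-- On the positive half-line (the negative one is symmetric), if l₁ < l₂ < s₀ < r and the outer points
-- have one colour, then r / l₂ is bounded, so l₂ and r lie in one interval [q^a , q^(a+1)). If
-- l < s₀ < r₁ < r₂, then r₂ / r₁ is bounded, so r₁ and r₂ share an interval; as q is close to 1 the
-- copy is small compared with r₁, so l is in the same interval.
--
-- A complete ordered field decides ¬ A ⊎ ¬ ¬ A (take the supremum of {0} ∪ {1 | A}), which is enough
-- classical logic to define the colouring.

open import Algebra.Bundles using (CommutativeRing)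
open import Data.Empty using (⊥; ⊥-elim)
open import Data.Fin as Fin using (Fin; zero; suc; toℕ; fromℕ<; combine; funToFin; finToFun; punchOut)
open import Data.Fin.Properties as Finₚ
  using (toℕ-fromℕ<; toℕ-injective; toℕ<n; combine-injective; finToFun-funToFin; pigeonhole; punchOut-injective; punchOut-cong)
open import Data.Integer as ℤ using (ℤ)
import Data.Integer.Properties as ℤₚ
open import Data.List using (List; []; _∷_; length; lookup)
open import Data.List.Membership.DecPropositional ℤ._≟_ using (_∈?_)
open import Data.List.Membership.Propositional using (_∈_; _∉_; find)
open import Data.List.Membership.Propositional.Properties using (∈-lookup)
open import Data.List.Relation.Unary.All as All using ([]; _∷_)
open import Data.List.Relation.Unary.All.Properties using (¬All⇒Any¬; ¬Any⇒All¬)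
open import Data.List.Relation.Unary.AllPairs using ([]; _∷_)
open import Data.List.Relation.Unary.Any as Any using (any?; here; there)
open import Data.List.Relation.Unary.Any.Properties using (lookup-index)
open import Data.List.Relation.Unary.Unique.Propositional using (Unique)
open import Data.Nat as ℕ using (ℕ; zero; suc; z≤n; s≤s; z<s)
open import Data.Nat.DivMod using (_/_; _%_; m≡m%n+[m/n]*n; m%n<n; [m+kn]%n≡m%n; m<n⇒m%n≡m)
import Data.Nat.Properties as ℕₚ
import Data.Nat.Solver as ℕ-Solver
open import Data.Product using (Σ; ∃; _×_; _,_; proj₁; proj₂)
open import Data.Sum using (_⊎_; inj₁; inj₂)
open import Defs
open import Function using (_∘_)
open import Function.Bundles using (_⇔_; mk⇔)
open import Relation.Binary using (tri<; tri≈; tri>; StrictPartialOrder)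
open import Relation.Binary.PropositionalEquality
import Relation.Binary.Reasoning.StrictPartialOrder as StrictReasoning
open import Relation.Binary.Structures using (IsStrictTotalOrder)
open import Relation.Nullary using (¬_; yes; no)
open import Relation.Nullary.Decidable using (decidable-stable)
open import Relation.Nullary.Negation using (contradiction)

-- Colourings of ℕ

module Combinatorics where
  open import Data.Nat using (_+_; _*_; _∸_; _^_; _≤_; _<_)
  open import Data.Nat.Properties
  open ℕ-Solver.+-*-Solver

  -- Van der Waerden's theorem by colour focusing

  MonoAP : {k : ℕ} → (ℕ → Fin k) → ℕ → ℕ → Set
  MonoAP χ l N = Σ ℕ λ a → Σ ℕ λ d → a ≤ N × suc d ≤ N ×
    (∀ j → j < l → χ (a + j * suc d) ≡ χ a)

  -- r progressions of length l with distinct colours, all of which would hit f as their next term.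
  Focused : {k : ℕ} → (ℕ → Fin k) → ℕ → ℕ → ℕ → Set
  Focused {k} χ l r N = Σ ℕ λ f → f ≤ N × Σ (Fin r → Fin k) λ col →
    (∀ i j → i Fin.< j → col i ≢ col j) ×
    (∀ i → Σ ℕ λ a → Σ ℕ λ d → suc d ≤ N ×
       a + l * suc d ≡ f × (∀ j → j < l → χ (a + j * suc d) ≡ col i))

  -- A whole window of `suc N` points becomes one colour, so that a monochromatic progression for
  -- `block` is a progression of identically coloured windows.
  block : {k : ℕ} (N : ℕ) → (ℕ → Fin k) → ℕ → Fin (k ^ suc N)
  block N χ x = funToFin (λ (i : Fin (suc N)) → χ (x + toℕ i))

  block-≡ : ∀ {k} N (χ : ℕ → Fin k) x y → block N χ x ≡ block N χ y →
    ∀ i → i ≤ N → χ (x + i) ≡ χ (y + i)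
  block-≡ N χ x y eq i i≤N =
    subst (λ n → χ (x + n) ≡ χ (y + n)) (toℕ-fromℕ< (s≤s i≤N))
      (trans (sym (finToFun-funToFin (λ (i : Fin (suc N)) → χ (x + toℕ i)) i′))
        (trans (cong (λ c → finToFun c i′) eq)
          (finToFun-funToFin (λ (i : Fin (suc N)) → χ (y + toℕ i)) i′)))
    where i′ = fromℕ< (s≤s i≤N)

  -- Induction on `r`: van der Waerden for windows gives `l` identically coloured windows in
  -- progression, and the induction hypothesis is applied inside the first. `N` bounds starts, steps
  -- and foci only, since the colouring is defined on all of ℕ.
  focus : ∀ l → (∀ k → Σ ℕ λ N → ∀ (χ : ℕ → Fin k) → MonoAP χ l N) →
    ∀ k r → Σ ℕ λ N → ∀ (χ : ℕ → Fin k) → MonoAP χ (suc l) N ⊎ Focused χ l r N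
  focus l vdW k zero = 0 , λ χ → inj₂ (0 , z≤n , (λ ()) , (λ ()) , (λ ()))
  -- The new focus will be `x + f + l * suc d`, where `x` and `suc d` are at most `W` and `f` is at
  -- most `N`.
  focus l vdW k (suc r) = W + N + l * W , go
    where
    N = proj₁ (focus l vdW k r)
    W = proj₁ (vdW (k ^ suc N))
    go : ∀ (χ : ℕ → Fin k) → MonoAP χ (suc l) (W + N + l * W) ⊎ Focused χ l (suc r) (W + N + l * W)
    go χ with proj₂ (vdW (k ^ suc N)) (block N χ)
    ... | x , d , x≤W , d<W , same with proj₂ (focus l vdW k r) (λ n → χ (x + n))
    ...   | inj₁ (a , e , a≤N , e<N , mono) = inj₁ (x + a , e ,
              ≤-trans (+-mono-≤ x≤W a≤N) (m≤m+n _ _) , ≤-trans e<N (≤-trans (m≤n+m N W) (m≤m+n _ _)) ,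
              λ j j< → trans (cong χ (+-assoc x a _)) (mono j j<))
    ...   | inj₂ (f , f≤N , col , distinct , aps)
            with Finₚ.any? (λ i → χ (x + f) Finₚ.≟ col i)
    -- The focus has the colour of one of the progressions that point to it, and so prolongs it.
    ...     | yes (i , hit) = inj₁ (x + a , e ,
                ≤-trans (+-mono-≤ x≤W (≤-trans (m+n≤o⇒m≤o a (≤-reflexive a+le≡f)) f≤N)) (m≤m+n _ _) ,
                ≤-trans (proj₁ (proj₂ (proj₂ (aps i)))) (≤-trans (m≤n+m N W) (m≤m+n _ _)) , mono)
              where
              a = proj₁ (aps i)
              e = proj₁ (proj₂ (aps i))
              a+le≡f : a + l * suc e ≡ f
              a+le≡f = proj₁ (proj₂ (proj₂ (proj₂ (aps i))))
              colour : ∀ j → j < suc l → χ (x + a + j * suc e) ≡ col i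
              colour j j< with m≤n⇒m<n∨m≡n (≤-pred j<)
              ... | inj₁ j<l = trans (cong χ (+-assoc x a _)) (proj₂ (proj₂ (proj₂ (proj₂ (aps i)))) j j<l)
              ... | inj₂ refl = trans (cong χ (trans (+-assoc x a _) (cong (x +_) a+le≡f))) hit
              mono : ∀ j → j < suc l → χ (x + a + j * suc e) ≡ χ (x + a)
              mono j j< = trans (colour j j<)
                (sym (trans (cong χ (sym (+-identityʳ (x + a)))) (colour 0 z<s)))
    -- The colour of the old focus is new, so its copies in the `l` windows form one more
    -- progression. The new focus is the corresponding position one window further on.
    ...     | no miss = inj₂ (x + f + l * suc d , le , col′ , distinct′ , aps′)
              where
              le : x + f + l * suc d ≤ W + N + l * W
              le = +-mono-≤ (+-mono-≤ x≤W f≤N) (*-monoʳ-≤ l d<W)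
              col′ : Fin (suc r) → Fin k
              col′ zero = χ (x + f)
              col′ (suc i) = col i
              distinct′ : ∀ i j → i Fin.< j → col′ i ≢ col′ j
              distinct′ zero (suc j) _ eq = miss (j , eq)
              distinct′ (suc i) (suc j) (s≤s i<j) = distinct i j i<j
              shift : ∀ j → j < l → ∀ i → i ≤ N → χ (x + j * suc d + i) ≡ χ (x + i)
              shift j j<l = block-≡ N χ _ _ (same j j<l)
              aps′ : ∀ i → Σ ℕ λ a → Σ ℕ λ e → suc e ≤ W + N + l * W ×
                     a + l * suc e ≡ x + f + l * suc d ×
                     (∀ j → j < l → χ (a + j * suc e) ≡ col′ i)
              aps′ zero = x + f , d , ≤-trans d<W (≤-trans (m≤m+n W N) (m≤m+n _ _)) , refl , λ j j<l →
                trans (cong χ (solve 3 (λ x f y → x :+ f :+ y := (x :+ y) :+ f) refl x f (j * suc d)))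
                  (shift j j<l f f≤N)
              -- With the two steps added, the `j`-th term is the old `j`-th term moved to the
              -- `j`-th window, where it keeps its colour.
              aps′ (suc i) with aps i
              ... | a , e , e<N , refl , mono = x + a , e + suc d ,
                    ≤-trans (≤-trans (≤-reflexive (+-comm (suc e) (suc d))) (+-mono-≤ d<W e<N)) (m≤m+n _ _) ,
                    solve 5 (λ x a l d e → x :+ a :+ l :* (con 1 :+ (e :+ d)) := x :+ (a :+ l :* (con 1 :+ e)) :+ l :* d)
                      refl x a l (suc d) e ,
                    λ j j<l → trans
                      (cong χ (solve 5 (λ x a j d e → x :+ a :+ j :* (con 1 :+ (e :+ d)) := (x :+ j :* d) :+ (a :+ j :* (con 1 :+ e)))
                        refl x a j (suc d) e))
                      (trans (shift j j<l _ (≤-trans (+-monoʳ-≤ a (*-monoˡ-≤ (suc e) (<⇒≤ j<l))) f≤N))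
                        (mono j j<l))

  -- Asking `focus` for `suc k` distinct colours out of `k` leaves only the outcome of a longer
  -- progression.
  vanDerWaerden : ∀ l k → Σ ℕ λ N → ∀ (χ : ℕ → Fin k) → MonoAP χ l N
  -- The bound is 1 because it must admit the step `suc 0`.
  vanDerWaerden zero k = 1 , λ χ → 0 , 0 , z≤n , s≤s z≤n , λ j ()
  vanDerWaerden (suc l) k = proj₁ many , λ χ → resolve χ (proj₂ many χ)
    where
    many = focus l (vanDerWaerden l) k (suc k)
    resolve : ∀ χ → MonoAP χ (suc l) (proj₁ many) ⊎ Focused χ l (suc k) (proj₁ many) → MonoAP χ (suc l) (proj₁ many)
    resolve χ (inj₁ ap) = ap
    resolve χ (inj₂ (_ , _ , col , distinct , _)) with pigeonhole (n<1+n k) col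
    ... | i , j , i<j , eq = contradiction eq (distinct i j i<j)

  -- Closure properties that no AP-free colouring has

  NonConstantAP : {k : ℕ} → (ℕ → Fin k) → ℕ → ℕ → Set
  NonConstantAP χ r d = ∃ λ m → χ (r + m * suc d) ≢ χ r

  apFree⇒¬¬nonConstant : ∀ {k} {χ : ℕ → Fin k} → APFreeℕ χ → ∀ r d → ¬ ¬ NonConstantAP χ r d
  apFree⇒¬¬nonConstant {χ = χ} free r d none = free (r , suc d , (λ ()) , same)
    where
    same : ∀ m → χ (r + m * suc d) ≡ χ r
    same m with χ (r + m * suc d) Finₚ.≟ χ r
    ... | yes eq = eq
    ... | no neq = ⊥-elim (none (m , neq))

  right-closed⇒⊥ : ∀ {k} {χ : ℕ → Fin k} (T : ℕ) → APFreeℕ χ →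
    (∀ a d c → (∀ j → j < T → χ (a + j * suc d) ≡ c) → χ (a + T * suc d) ≡ c) → ⊥
  right-closed⇒⊥ {k} {χ} T free closed with proj₂ (vanDerWaerden T k) χ
  ... | y , d , _ , _ , mono = free (y , suc d , (λ ()) , λ m → extended (suc m) m (n<1+n m))
    where
    -- `n` bounds a course-of-values recursion: the colour of term `j` comes from the `T` terms
    -- before it.
    extended : ∀ n j → j < n → χ (y + j * suc d) ≡ χ y
    extended (suc n) j j<1+n with j <? T
    ... | yes j<T = mono j j<T
    ... | no j≮T = trans (cong χ (trans (cong (λ n → y + n * suc d) (sym i+T≡j)) (position T))) (closed (y + i * suc d) d (χ y) earlier)
      where
      i = j ∸ T
      i+T≡j : i + T ≡ j
      i+T≡j = m∸n+n≡m (≮⇒≥ j≮T)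
      position : ∀ t → y + (i + t) * suc d ≡ y + i * suc d + t * suc d
      position t = solve 4 (λ y i t d → y :+ (i :+ t) :* d := y :+ i :* d :+ t :* d) refl y i t (suc d)
      earlier : ∀ t → t < T → χ (y + i * suc d + t * suc d) ≡ χ y
      earlier t t<T = trans (cong χ (sym (position t)))
        (extended n (i + t) (<-≤-trans (+-monoʳ-< i t<T) (≤-trans (≤-reflexive i+T≡j) (≤-pred j<1+n))))

  -- Finitely many double negations can be merged into one, and monotonicity lets the sum of the
  -- individual bounds serve as a common bound.
  ¬¬-bounded : (A : ℕ → ℕ → Set) → (∀ d {M N} → M ≤ N → A d M → A d N) →
    (∀ d → ¬ ¬ ∃ (A d)) → ∀ W → ¬ ¬ ∃ λ N → ∀ d → d < W → A d N
  ¬¬-bounded A mono each zero none = none (0 , λ d ())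
  ¬¬-bounded A mono each (suc W) none =
    ¬¬-bounded A mono each W λ (M , below) → each W λ (N , last) →
      none (M + N , λ d d<1+W → all M below N last d (m≤n⇒m<n∨m≡n (≤-pred d<1+W)))
    where
    all : ∀ M → (∀ d → d < W → A d M) → ∀ N → A W N → ∀ d → d < W ⊎ d ≡ W → A d (M + N)
    all M below N last d (inj₁ d<W) = mono d (m≤m+n M N) (below d d<W)
    all M below N last d (inj₂ refl) = mono d (m≤n+m N M) last

  -- The order of choices matters: `W` depends only on `T` and `k`, so an `N` can be fixed by which
  -- every progression with start below `W` and step at most `W` has changed colour. A monochromatic
  -- progression found beyond `N` then extends left to such a start without any change.
  left-closed⇒⊥ : ∀ {k} {χ : ℕ → Fin k} (T : ℕ) → APFreeℕ χ →
    (∀ a d c → (∀ j → 1 ≤ j → j ≤ T → χ (a + j * suc d) ≡ c) → χ a ≡ c) → ⊥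
  left-closed⇒⊥ {k} {χ} T free closed = ¬¬-bounded _ column-mono column W contra
    where
    W = proj₁ (vanDerWaerden (suc T) k)
    Breaks : ℕ → ℕ → ℕ → Set
    Breaks d r N = ∃ λ m → r + m * suc d ≤ N × χ (r + m * suc d) ≢ χ r
    breaks : ∀ d r → ¬ ¬ ∃ (Breaks d r)
    breaks d r none = apFree⇒¬¬nonConstant free r d λ (m , neq) → none (_ , m , ≤-refl , neq)
    breaks-mono : ∀ d r {M N} → M ≤ N → Breaks d r M → Breaks d r N
    breaks-mono d r M≤N (m , le , neq) = m , ≤-trans le M≤N , neq
    column : ∀ d → ¬ ¬ ∃ λ N → ∀ r → r < W → Breaks d r N
    column d = ¬¬-bounded (Breaks d) (breaks-mono d) (breaks d) W
    column-mono : ∀ d {M N} → M ≤ N → (∀ r → r < W → Breaks d r M) → ∀ r → r < W → Breaks d r N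
    column-mono d M≤N all r r<W = breaks-mono d r M≤N (all r r<W)
    contra : ¬ ∃ λ N → ∀ d → d < W → ∀ r → r < W → Breaks d r N
    contra (N , all) with proj₂ (vanDerWaerden (suc T) k) (λ n → χ (N + n))
    ... | a , d , _ , d<W , mono = proj₂ (proj₂ broken)
        (trans (constant m (s≤s (≤-trans m≤e (m≤m+n e T))))
          (sym (trans (cong χ (sym (+-identityʳ r))) (constant 0 z<s))))
      where
      y = N + a
      r = y % suc d
      e = y / suc d
      col = χ y
      -- `e` is the number of steps from `z` up to `y`; each recursive step adds one term on the
      -- left.
      extended : ∀ e z → z + e * suc d ≡ y → ∀ j → j < suc (e + T) → χ (z + j * suc d) ≡ col
      extended zero z z≡y j j< = trans (cong χ (trans (cong (_+ j * suc d) (trans (sym (+-identityʳ z)) z≡y)) (+-assoc N a _))) (mono j j<)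
      extended (suc e) z z≡y = λ where
          zero _ → trans (cong χ (+-identityʳ z)) (closed z d col λ j 1≤j j≤T → tail j 1≤j (s≤s (≤-trans j≤T (≤-trans (m≤n+m T e) (n≤1+n _)))))
          (suc j) j< → tail (suc j) (s≤s z≤n) j<
        where
        tail : ∀ j → 1 ≤ j → j < suc (suc e + T) → χ (z + j * suc d) ≡ col
        tail (suc j) _ (s≤s j<) = trans (cong χ (sym (+-assoc z (suc d) _)))
          (extended e (z + suc d) (trans (+-assoc z (suc d) _) z≡y) j j<)
      constant : ∀ j → j < suc (e + T) → χ (r + j * suc d) ≡ col
      constant = extended e r (sym (m≡m%n+[m/n]*n y (suc d)))
      broken : Breaks d r N
      broken = all d d<W r (<-≤-trans (m%n<n y (suc d)) d<W)
      m = proj₁ broken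
      m≤e : m ≤ e
      m≤e = *-cancelʳ-≤ m e (suc d) (+-cancelˡ-≤ r _ _ (≤-trans (proj₁ (proj₂ broken))
        (≤-trans (m≤m+n N a) (≤-reflexive (m≡m%n+[m/n]*n y (suc d))))))

  -- The middle point divides the segment in the ratio `p : q`; this is the closure property that a
  -- three-point set imposes.
  WeightedConvex : {k : ℕ} → (ℕ → Fin k) → ℕ → ℕ → Set
  WeightedConvex χ p q = ∀ x d → χ (x + (p + q) * suc d) ≡ χ x → χ (x + p * suc d) ≡ χ x

  -- Induction on the number of colours: if a block of colour `c` cannot be prolonged, a whole
  -- progression avoids `c`, and the colouring along it inherits both hypotheses with one colour
  -- fewer.
  convex⇒⊥ : ∀ k (χ : ℕ → Fin k) p q → 1 ≤ p → 1 ≤ q → APFreeℕ χ → WeightedConvex χ p q → ⊥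
  convex⇒⊥ zero χ _ _ _ _ free convex with () ← χ 0
  convex⇒⊥ (suc k) χ (suc p′) (suc q′) 1≤p 1≤q free convex with proj₂ (vanDerWaerden (suc p′ + suc q′) (suc k)) χ
  ... | y , d , _ , _ , mono = free (y , suc d , (λ ()) , λ m → at m)
    where
    p = suc p′
    q = suc q′
    Q = p + q
    c = χ y
    pos : ℕ → ℕ
    pos m = y + m * suc d
    Block : ℕ → Set
    Block n = ∀ j → j < Q → χ (pos (n + j)) ≡ c
    -- A point of colour c beyond the block and congruent to n + Q modulo q could be combined
    -- with a point of the block to give a smaller such point, ending at n + Q itself.
    avoids : ∀ n → Block n → χ (pos (n + Q)) ≢ c → ∀ b t → t < b → χ (pos (n + Q + q * t)) ≢ c
    avoids n full missing (suc b) zero t<b eq =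
      missing (trans (cong (λ m → χ (pos m)) (sym (trans (cong (n + Q +_) (*-zeroʳ q)) (+-identityʳ (n + Q))))) eq)
    avoids n full missing (suc b) t@(suc t₁) (s≤s t<b) eq =
      avoids n full missing b r (≤-trans (s≤s (m∸n≤m t₁ u)) t<b)
        (trans (cong χ lower) (trans (convex x D (trans (cong χ (sym upper)) (trans eq (sym xc)))) xc))
      where
      -- The block point at `n + j` is chosen so that the far point lies `Q * suc u` steps beyond
      -- it. With `suc D = suc u * suc d`, convexity hits the point `p * suc u` steps beyond, which
      -- is `n + Q + q * r` with `r < t`.
      j = (q * t) % Q
      u = (q * t) / Q
      split : q * t ≡ j + u * Q
      split = m≡m%n+[m/n]*n (q * t) Q
      u≤t₁ : u ≤ t₁
      u≤t₁ = ≤-pred (*-cancelʳ-< Q u t (begin-strict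
        u * Q      ≤⟨ m≤n+m (u * Q) j ⟩
        j + u * Q  ≡⟨ sym split ⟩
        q * t      <⟨ *-monoˡ-< t (m<n+m q {p} z<s) ⟩
        Q * t      ≡⟨ *-comm Q t ⟩
        t * Q      ∎))
        where open ≤-Reasoning
      r = t₁ ∸ u
      x = pos (n + j)
      xc : χ x ≡ c
      xc = full j (m%n<n (q * t) Q)
      D = d + u * suc d
      upper : pos (n + Q + q * t) ≡ x + Q * suc D
      upper = trans (cong (λ v → pos (n + Q + v)) split)
        (solve 6 (λ y n Q j u d → y :+ (n :+ Q :+ (j :+ u :* Q)) :* (con 1 :+ d)
            := y :+ (n :+ j) :* (con 1 :+ d) :+ Q :* (con 1 :+ (d :+ u :* (con 1 :+ d)))) refl y n Q j u d)
      counts : Q + q * r ≡ j + p * suc u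
      counts = +-cancelʳ-≡ (q * suc u) _ _ (begin
        Q + q * r + q * suc u    ≡⟨ solve 4 (λ Q q r u → Q :+ q :* r :+ q :* (con 1 :+ u) := Q :+ q :* (con 1 :+ (r :+ u))) refl Q q r u ⟩
        Q + q * suc (r + u)      ≡⟨ cong (λ v → Q + q * suc v) (m∸n+n≡m u≤t₁) ⟩
        Q + q * t                ≡⟨ cong (Q +_) split ⟩
        Q + (j + u * Q)          ≡⟨ solve 4 (λ p q j u → (p :+ q) :+ (j :+ u :* (p :+ q)) := j :+ p :* (con 1 :+ u) :+ q :* (con 1 :+ u)) refl p q j u ⟩
        j + p * suc u + q * suc u ∎)
        where open ≡-Reasoning
      lower : pos (n + Q + q * r) ≡ x + p * suc D
      lower = trans (cong pos (trans (+-assoc n Q _) (cong (n +_) counts)))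
        (solve 6 (λ y n p j u d → y :+ (n :+ (j :+ p :* (con 1 :+ u))) :* (con 1 :+ d)
            := y :+ (n :+ j) :* (con 1 :+ d) :+ p :* (con 1 :+ (d :+ u :* (con 1 :+ d)))) refl y n p j u d)
    next : ∀ n → Block n → χ (pos (n + Q)) ≡ c
    next n full with χ (pos (n + Q)) Finₚ.≟ c
    ... | yes eq = eq
    ... | no missing = ⊥-elim (convex⇒⊥ k χ′ p q 1≤p 1≤q free′ convex′)
      where
      -- Thus `suc e` equals `q * suc d`.
      e = d + q′ * suc d
      point : ℕ → ℕ
      point t = pos (n + Q) + t * suc e
      c≢ : ∀ t → c ≢ χ (point t)
      c≢ t eq = avoids n full missing (suc t) t (n<1+n t) (trans (cong χ shape) (sym eq))
        where
        shape : pos (n + Q + q * t) ≡ point t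
        shape = solve 5 (λ y m q′ t d → y :+ (m :+ (con 1 :+ q′) :* t) :* (con 1 :+ d)
          := y :+ m :* (con 1 :+ d) :+ t :* (con 1 :+ (d :+ q′ :* (con 1 :+ d)))) refl y (n + Q) q′ t d
      χ′ : ℕ → Fin k
      χ′ t = punchOut (c≢ t)
      affine : ∀ a m s → point (a + m * s) ≡ point a + m * (s * suc e)
      affine a m s = solve 5 (λ z a m s e → z :+ (a :+ m :* s) :* e := z :+ a :* e :+ m :* (s :* e)) refl (pos (n + Q)) a m s (suc e)
      free′ : APFreeℕ χ′
      free′ (a , zero , t≢0 , _) = t≢0 refl
      free′ (a , suc t , _ , same) = free (point a , suc t * suc e , (λ ()) , λ m →
        trans (cong χ (sym (affine a m (suc t)))) (punchOut-injective (c≢ (a + m * suc t)) (c≢ a) (same m)))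
      convex′ : WeightedConvex χ′ p q
      convex′ x s eq = punchOut-cong c (trans (cong χ (affine x p (suc s)))
        (convex (point x) _ (trans (cong χ (sym (affine x Q (suc s)))) (punchOut-injective (c≢ (x + Q * suc s)) (c≢ x) eq))))
    blocks : ∀ n → Block n
    blocks zero j j<Q = mono j j<Q
    blocks (suc n) j j<Q with m≤n⇒m<n∨m≡n j<Q
    ... | inj₁ 1+j<Q = trans (cong (λ m → χ (pos m)) (sym (+-suc n j))) (blocks n (suc j) 1+j<Q)
    ... | inj₂ 1+j≡Q = trans (cong (λ m → χ (pos m)) (trans (sym (+-suc n j)) (cong (n +_) 1+j≡Q))) (next n (blocks n))
    at : ∀ m → χ (pos m) ≡ c
    at m = trans (cong (λ v → χ (pos v)) (sym (+-identityʳ m))) (blocks m 0 z<s)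

open Combinatorics

-- The complete ordered field

module OrderedField (R : CompleteOrderedField) where
  open CompleteOrderedField R

  commutativeRing : CommutativeRing _ _
  commutativeRing = record { isCommutativeRing = isCommutativeRing }

  strictPartialOrder : StrictPartialOrder _ _ _
  strictPartialOrder = record
    { isStrictPartialOrder = IsStrictTotalOrder.isStrictPartialOrder <-isStrictTotalOrder }

  open StrictPartialOrder strictPartialOrder public using ()
    renaming (irrefl to <-irrefl; trans to <-trans; asym to <-asym)
  open IsStrictTotalOrder <-isStrictTotalOrder public using (compare)
  open CommutativeRing commutativeRing public using
    ( +-comm; +-assoc; +-identityˡ; +-identityʳ; *-comm; *-assoc; *-identityˡ; *-identityʳ
    ; distribˡ; zeroˡ; zeroʳ; -‿inverseʳ; -‿inverseˡ )
  open import Algebra.Solver.Ring.NaturalCoefficients.Default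
    (CommutativeRing.commutativeSemiring commutativeRing) public
  module ≤-Reasoning = StrictReasoning strictPartialOrder
  open ≤-Reasoning

  ι : ℕ → Carrier
  ι = fromℕ R

  ≤-refl : ∀ {x} → x ≤ x
  ≤-refl = inj₂ refl

  <⇒≤ : ∀ {x y} → x < y → x ≤ y
  <⇒≤ = inj₁

  ≤-trans : ∀ {x y z} → x ≤ y → y ≤ z → x ≤ z
  ≤-trans (inj₂ refl) y≤z = y≤z
  ≤-trans (inj₁ x<y) (inj₁ y<z) = inj₁ (<-trans x<y y<z)
  ≤-trans (inj₁ x<y) (inj₂ refl) = inj₁ x<y

  <-≤-trans : ∀ {x y z} → x < y → y ≤ z → x < z
  <-≤-trans x<y (inj₁ y<z) = <-trans x<y y<z
  <-≤-trans x<y (inj₂ refl) = x<y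

  ≤-<-trans : ∀ {x y z} → x ≤ y → y < z → x < z
  ≤-<-trans (inj₁ x<y) y<z = <-trans x<y y<z
  ≤-<-trans (inj₂ refl) y<z = y<z

  <⇒≱ : ∀ {x y} → x < y → ¬ y ≤ x
  <⇒≱ x<y y≤x = <-irrefl refl (<-≤-trans x<y y≤x)

  <-or-≥ : ∀ x y → x < y ⊎ y ≤ x
  <-or-≥ x y with compare x y
  ... | tri< x<y _ _ = inj₁ x<y
  ... | tri≈ _ x≡y _ = inj₂ (inj₂ (sym x≡y))
  ... | tri> _ _ y<x = inj₂ (inj₁ y<x)

  ≮⇒≥ : ∀ {x y} → ¬ x < y → y ≤ x
  ≮⇒≥ {x} {y} x≮y with <-or-≥ x y
  ... | inj₁ x<y = ⊥-elim (x≮y x<y)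
  ... | inj₂ y≤x = y≤x

  +-mono-< : ∀ {w x y z} → w < x → y < z → w + y < x + z
  +-mono-< {w} {x} {y} {z} w<x y<z =
    <-trans (+-monoˡ-< y w<x) (subst₂ _<_ (+-comm y x) (+-comm z x) (+-monoˡ-< x y<z))

  +-monoˡ-≤ : ∀ {x y} z → x ≤ y → x + z ≤ y + z
  +-monoˡ-≤ z (inj₁ x<y) = inj₁ (+-monoˡ-< z x<y)
  +-monoˡ-≤ z (inj₂ refl) = inj₂ refl

  +-monoʳ-< : ∀ {x y} z → x < y → z + x < z + y
  +-monoʳ-< {x} {y} z x<y = subst₂ _<_ (+-comm x z) (+-comm y z) (+-monoˡ-< z x<y)

  +-monoʳ-≤ : ∀ {x y} z → x ≤ y → z + x ≤ z + y
  +-monoʳ-≤ {x} {y} z x≤y = subst₂ _≤_ (+-comm x z) (+-comm y z) (+-monoˡ-≤ z x≤y)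

  +-mono-≤ : ∀ {w x y z} → w ≤ x → y ≤ z → w + y ≤ x + z
  +-mono-≤ {x = x} {y = y} w≤x y≤z = ≤-trans (+-monoˡ-≤ y w≤x) (+-monoʳ-≤ x y≤z)

  cancel-right : ∀ x z → x + z + - z ≡ x
  cancel-right x z = trans (+-assoc x z (- z)) (trans (cong (x +_) (-‿inverseʳ z)) (+-identityʳ x))

  +-cancelʳ-< : ∀ {x y} z → x + z < y + z → x < y
  +-cancelʳ-< {x} {y} z lt = subst₂ _<_ (cancel-right x z) (cancel-right y z) (+-monoˡ-< (- z) lt)

  x<x+e : ∀ {x e} → 0# < e → x < x + e
  x<x+e {x} {e} 0<e = subst (_< x + e) (+-identityʳ x) (+-monoʳ-< x 0<e)

  x≤x+e : ∀ {x e} → 0# ≤ e → x ≤ x + e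
  x≤x+e {x} {e} 0≤e = subst (_≤ x + e) (+-identityʳ x) (+-monoʳ-≤ x 0≤e)

  difference : ∀ {x y} → x < y → ∃ λ e → 0# < e × y ≡ x + e
  difference {x} {y} x<y = y + - x , subst (_< y + - x) (-‿inverseʳ x) (+-monoˡ-< (- x) x<y) ,
    sym (trans (+-comm x _) (trans (+-assoc y (- x) x) (trans (cong (y +_) (-‿inverseˡ x)) (+-identityʳ y))))

  *-monoˡ-< : ∀ {x y} z → 0# < z → x < y → z * x < z * y
  *-monoˡ-< {x} z 0<z x<y with difference x<y
  ... | e , 0<e , refl = subst (z * x <_) (sym (distribˡ z x e)) (x<x+e (*-pos 0<z 0<e))

  *-monoˡ-≤ : ∀ {x y} z → 0# < z → x ≤ y → z * x ≤ z * y
  *-monoˡ-≤ z 0<z (inj₁ x<y) = inj₁ (*-monoˡ-< z 0<z x<y)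
  *-monoˡ-≤ z 0<z (inj₂ refl) = inj₂ refl

  *-monoʳ-< : ∀ {x y} z → 0# < z → x < y → x * z < y * z
  *-monoʳ-< {x} {y} z 0<z x<y = subst₂ _<_ (*-comm z x) (*-comm z y) (*-monoˡ-< z 0<z x<y)

  *-monoʳ-≤ : ∀ {x y} z → 0# < z → x ≤ y → x * z ≤ y * z
  *-monoʳ-≤ {x} {y} z 0<z x≤y = subst₂ _≤_ (*-comm z x) (*-comm z y) (*-monoˡ-≤ z 0<z x≤y)

  0<1 : 0# < 1#
  0<1 with compare 0# 1#
  ... | tri< 0<1 _ _ = 0<1
  ... | tri≈ _ 0≡1 _ = ⊥-elim (0≢1 0≡1)
  ... | tri> _ _ 1<0 = ⊥-elim (<-irrefl refl (subst (0# <_) n*n+n≡0 (<-trans (*-pos 0<n 0<n) (x<x+e 0<n))))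
    where
    n = - 1#
    0<n : 0# < n
    0<n = subst₂ _<_ (-‿inverseʳ 1#) (+-identityˡ n) (+-monoˡ-< n 1<0)
    n*n+n≡0 : n * n + n ≡ 0#
    n*n+n≡0 = trans (solve 1 (λ n → n :* n :+ n := n :* (n :+ con 1)) refl n)
      (trans (cong (n *_) (-‿inverseˡ 1#)) (zeroʳ n))

  0<ι-suc : ∀ n → 0# < ι (suc n)
  0≤ι : ∀ n → 0# ≤ ι n
  0≤ι zero = ≤-refl
  0≤ι (suc n) = <⇒≤ (0<ι-suc n)
  0<ι-suc n = <-≤-trans 0<1 (x≤x+e (0≤ι n))

  1≤ι : ∀ {m} → 1 ℕ.≤ m → 1# ≤ ι m
  1≤ι (s≤s {n = m} _) = x≤x+e (0≤ι m)

  ι-+ : ∀ m n → ι (m ℕ.+ n) ≡ ι m + ι n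
  ι-+ zero n = sym (+-identityˡ _)
  ι-+ (suc m) n = trans (cong (1# +_) (ι-+ m n)) (sym (+-assoc 1# _ _))

  ι-* : ∀ m n → ι (m ℕ.* n) ≡ ι m * ι n
  ι-* zero n = sym (zeroˡ _)
  ι-* (suc m) n = trans (ι-+ n (m ℕ.* n)) (trans (cong (ι n +_) (ι-* m n))
    (solve 2 (λ m n → n :+ m :* n := (con 1 :+ m) :* n) refl (ι m) (ι n)))

  -- If the multiples of `t` were bounded with supremum `s`, then `s - t` would bound them too,
  -- since adding `t` to a multiple gives a multiple. Refuting boundedness yields the multiple only
  -- under double negation.
  archimedean : ∀ x t → 0# < t → ¬ ¬ ∃ λ m → x < ι m * t
  archimedean x t 0<t none with sup (λ y → ∃ λ m → y ≡ ι m * t) (_ , 0 , refl)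
    (x , λ { _ (m , refl) → ≮⇒≥ λ lt → none (m , lt) })
  ... | s , upper , least = <⇒≱ (x<x+e 0<t) (subst (s + t ≤_) back (+-monoˡ-≤ t (least (s + - t) bound)))
    where
    back : s + - t + t ≡ s
    back = trans (+-assoc s (- t) t) (trans (cong (s +_) (-‿inverseˡ t)) (+-identityʳ s))
    bound : ∀ b → (∃ λ m → b ≡ ι m * t) → b ≤ s + - t
    bound _ (m , refl) = subst (_≤ s + - t) (cancel-right _ t)
      (+-monoˡ-≤ (- t) (≤-trans (inj₂ (solve 2 (λ m t → m :* t :+ t := (con 1 :+ m) :* t) refl (ι m) t))
        (upper _ (suc m , refl))))

  weakExcludedMiddle : (A : Set) → ¬ A ⊎ ¬ ¬ A
  weakExcludedMiddle A with sup (λ x → x ≡ 0# ⊎ (x ≡ 1# × A)) (0# , inj₁ refl)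
    (1# , λ { _ (inj₁ refl) → <⇒≤ 0<1 ; _ (inj₂ (refl , _)) → ≤-refl })
  ... | s , upper , least with <-or-≥ s 1#
  ...   | inj₁ s<1 = inj₁ λ a → <⇒≱ s<1 (upper 1# (inj₂ (refl , a)))
  ...   | inj₂ 1≤s = inj₂ λ ¬a → <⇒≱ 0<1 (≤-trans 1≤s (least 0# λ
            { _ (inj₁ refl) → ≤-refl ; _ (inj₂ (_ , a)) → ⊥-elim (¬a a) }))

  -- Going through the candidates with `weakExcludedMiddle` produces an actual index; only its
  -- property stays under double negation. This is what makes the colour of a point a genuine value.
  weakChoice : ∀ n (A : Fin n → Set) → ¬ ¬ ∃ A → ∃ λ i → ¬ ¬ A i
  weakChoice zero A some = ⊥-elim (some λ ())
  weakChoice (suc n) A some with weakExcludedMiddle (A zero)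
  ... | inj₂ ¬¬a = zero , ¬¬a
  ... | inj₁ ¬a with weakChoice n (A ∘ suc) (λ none → some λ { (zero , a) → ¬a a ; (suc i , a) → none (i , a) })
  ...   | i , ¬¬a = suc i , ¬¬a

  fromℤ-⊖ : ∀ m n → fromℤ R (m ℤ.⊖ n) + ι n ≡ ι m
  fromℤ-⊖ m zero = +-identityʳ _
  fromℤ-⊖ zero (suc n) = -‿inverseˡ _
  fromℤ-⊖ (suc m) (suc n) = trans
    (cong (_+ ι (suc n)) (cong (fromℤ R) (ℤₚ.[1+m]⊖[1+n]≡m⊖n m n)))
    (trans (solve 2 (λ z n → z :+ (con 1 :+ n) := con 1 :+ (z :+ n)) refl _ (ι n)) (cong (1# +_) (fromℤ-⊖ m n)))

  fromℤ-+ℕ : ∀ z n → fromℤ R (z ℤ.+ (ℤ.+ n)) ≡ fromℤ R z + ι n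
  fromℤ-+ℕ (ℤ.+ m) n = ι-+ m n
  fromℤ-+ℕ ℤ.-[1+ m ] n = trans (sym (cancel-right _ (ι (suc m))))
    (trans (cong (_+ - ι (suc m)) (fromℤ-⊖ n (suc m))) (+-comm _ _))

  fromℤ-∣-∣ : ∀ {z w} → z ℤ.≤ w → fromℤ R w ≡ fromℤ R z + ι ℤ.∣ w ℤ.- z ∣
  fromℤ-∣-∣ {z} {w} z≤w = trans (cong (fromℤ R) (sym shape)) (fromℤ-+ℕ z _)
    where
    shape : z ℤ.+ (ℤ.+ ℤ.∣ w ℤ.- z ∣) ≡ w
    shape = trans (cong (λ v → z ℤ.+ v) (ℤₚ.0≤i⇒+∣i∣≡i (ℤₚ.i≤j⇒0≤j-i z≤w)))
      (trans (ℤₚ.+-comm z _) (trans (ℤₚ.+-assoc w (ℤ.- z) z) (trans (cong (λ v → w ℤ.+ v) (ℤₚ.+-inverseˡ z)) (ℤₚ.+-identityʳ w))))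

-- q = 1 + 1/N; the distances between the relevant points of a copy are at most M times the smallest
-- one, and K is chosen so that 1 + M ≤ q ^ (K - 1).
module Colouring (R : CompleteOrderedField) (M N n : ℕ)
  (1≤M : 1 ℕ.≤ M) (N≡M+M : N ≡ M ℕ.+ M) (n≡NM : n ≡ N ℕ.* M) where
  open CompleteOrderedField R
  open OrderedField R
  open ≤-Reasoning

  K : ℕ
  K = suc n

  1≤n : 1 ℕ.≤ n
  1≤n = ℕₚ.≤-trans (ℕₚ.*-mono-≤ (ℕₚ.≤-trans 1≤M (ℕₚ.m≤m+n M M)) 1≤M)
    (ℕₚ.≤-reflexive (trans (cong (ℕ._* M) (sym N≡M+M)) (sym n≡NM)))

  0<ιM : 0# < ι M
  0<ιM = <-≤-trans 0<1 (1≤ι 1≤M)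

  ιN≡ : ι N ≡ ι M + ι M
  ιN≡ = trans (cong ι N≡M+M) (ι-+ M M)

  0<ιN : 0# < ι N
  0<ιN = subst (0# <_) (sym ιN≡) (<-trans 0<ιM (x<x+e 0<ιM))

  N⁻¹ : ∃ λ κ → ι N * κ ≡ 1#
  N⁻¹ = inverse (ι N) (λ N≡0 → <-irrefl (sym N≡0) 0<ιN)

  κ q : Carrier
  κ = proj₁ N⁻¹
  q = 1# + κ

  Nκ≡1 : ι N * κ ≡ 1#
  Nκ≡1 = proj₂ N⁻¹

  0<κ : 0# < κ
  0<κ with <-or-≥ 0# κ
  ... | inj₁ 0<κ = 0<κ
  ... | inj₂ κ≤0 = ⊥-elim (<⇒≱ 0<1 (begin
    1#         ≡⟨ sym Nκ≡1 ⟩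
    ι N * κ    ≤⟨ *-monoˡ-≤ (ι N) 0<ιN κ≤0 ⟩
    ι N * 0#   ≡⟨ zeroʳ _ ⟩
    0#         ∎))

  -- Powers of `q` and the intervals between them

  q^ : ℕ → Carrier
  q^ zero = 1#
  q^ (suc a) = q * q^ a

  q^-suc : ∀ a → q^ (suc a) ≡ q^ a + κ * q^ a
  q^-suc a = solve 2 (λ κ x → (con 1 :+ κ) :* x := x :+ κ :* x) refl κ (q^ a)

  0<q : 0# < q
  0<q = <-trans 0<1 (x<x+e 0<κ)

  0<q^ : ∀ a → 0# < q^ a
  0<q^ zero = 0<1
  0<q^ (suc a) = *-pos 0<q (0<q^ a)

  q^-+ : ∀ a b → q^ (a ℕ.+ b) ≡ q^ a * q^ b
  q^-+ zero b = sym (*-identityˡ _)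
  q^-+ (suc a) b = trans (cong (q *_) (q^-+ a b)) (sym (*-assoc q _ _))

  q^-step : ∀ a → q^ a < q^ (suc a)
  q^-step a = subst (q^ a <_) (sym (q^-suc a)) (x<x+e (*-pos 0<κ (0<q^ a)))

  q^-mono : ∀ {a b} → a ℕ.≤ b → q^ a ≤ q^ b
  q^-mono {b = b} z≤n = 1≤q^ b
    where
    1≤q^ : ∀ b → 1# ≤ q^ b
    1≤q^ zero = ≤-refl
    1≤q^ (suc b) = ≤-trans (1≤q^ b) (<⇒≤ (q^-step b))
  q^-mono (s≤s a≤b) = *-monoˡ-≤ q 0<q (q^-mono a≤b)

  bernoulli : ∀ a → 1# + ι a * κ ≤ q^ a
  bernoulli zero = inj₂ (trans (cong (1# +_) (zeroˡ κ)) (+-identityʳ 1#))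
  bernoulli (suc a) = begin
    1# + (1# + ι a) * κ     ≡⟨ solve 2 (λ a κ → con 1 :+ (con 1 :+ a) :* κ := (con 1 :+ a :* κ) :+ κ :* con 1) refl (ι a) κ ⟩
    1# + ι a * κ + κ * 1#   ≤⟨ +-mono-≤ (bernoulli a) (*-monoˡ-≤ κ 0<κ (q^-mono {0} {a} z≤n)) ⟩
    q^ a + κ * q^ a         ≡⟨ sym (q^-suc a) ⟩
    q^ (suc a)              ∎

  1+M≤q^n : 1# + ι M ≤ q^ n
  1+M≤q^n = subst (λ x → 1# + x ≤ q^ n) nκ≡M (bernoulli n)
    where
    nκ≡M : ι n * κ ≡ ι M
    nκ≡M = trans (cong (_* κ) (trans (cong ι n≡NM) (ι-* N M))) (trans (solve 3 (λ N M κ → (N :* M) :* κ := M :* (N :* κ)) refl (ι N) (ι M) κ)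
      (trans (cong (ι M *_) Nκ≡1) (*-identityʳ _)))

  q^-unbounded : ∀ x → ¬ ¬ ∃ λ a → x < q^ a
  q^-unbounded x none = archimedean x κ 0<κ λ (m , lt) →
    none (m , <-≤-trans lt (≤-trans (subst (ι m * κ ≤_) (+-comm _ 1#) (x≤x+e (<⇒≤ 0<1))) (bernoulli m)))

  -- This says that `a` is the integer part of the logarithm of `x` to base `q`. As exponents are
  -- natural, only `x` with `1# ≤ x` have an index.
  record Index (x : Carrier) (a : ℕ) : Set where
    constructor within
    field
      lower : q^ a ≤ x
      upper : x < q^ (suc a)

  index-exists : ∀ {x} → 1# ≤ x → ∀ m → x < q^ m → ∃ (Index x)
  index-exists 1≤x zero x<1 = ⊥-elim (<⇒≱ x<1 1≤x)
  -- Searches downwards from a power known to exceed `x`.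
  index-exists {x} 1≤x (suc m) x< with <-or-≥ x (q^ m)
  ... | inj₁ x<q^m = index-exists 1≤x m x<q^m
  ... | inj₂ q^m≤x = m , within q^m≤x x<

  index-mono : ∀ {x y a b} → Index x a → Index y b → x ≤ y → a ℕ.≤ b
  index-mono {x} {y} {a} {b} (within q^a≤x _) (within _ y<) x≤y with a ℕ.≤? b
  ... | yes a≤b = a≤b
  ... | no a≰b = ⊥-elim (<⇒≱ (≤-<-trans (≤-trans q^a≤x x≤y) y<) (q^-mono (ℕₚ.≰⇒> a≰b)))

  index-scale : ∀ {x a} m → Index x a → Index (x * q^ m) (a ℕ.+ m)
  index-scale {x} {a} m (within lower upper) = within
    (subst (_≤ x * q^ m) (sym (q^-+ a m)) (*-monoʳ-≤ (q^ m) (0<q^ m) lower))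
    (subst (x * q^ m <_) (sym (q^-+ (suc a) m)) (*-monoʳ-< (q^ m) (0<q^ m) upper))

  -- The upper end of the interval of `x` costs one more factor `q` than the ratio `q^ n`, whence
  -- `K = suc n`.
  index-near : ∀ {x y a b} → Index x a → Index y b → y < q^ n * x → b ℕ.< a ℕ.+ K
  index-near {x} {y} {a} {b} (within _ x<) (within q^b≤y _) near with b ℕ.<? a ℕ.+ K
  ... | yes b< = b<
  ... | no b≮ = ⊥-elim (<⇒≱ (begin-strict
    y                  <⟨ near ⟩
    q^ n * x           <⟨ *-monoˡ-< (q^ n) (0<q^ n) x< ⟩
    q^ n * q^ (suc a)  ≡⟨ sym (q^-+ n (suc a)) ⟩
    q^ (n ℕ.+ suc a)   ≡⟨ cong q^ (trans (ℕₚ.+-suc n a) (ℕₚ.+-comm K a)) ⟩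
    q^ (a ℕ.+ K)       ∎) (≤-trans (q^-mono (ℕₚ.≮⇒≥ b≮)) q^b≤y))

  -- Indices modulo `K`

  class : Fin K → ℕ → ℕ
  class i c = toℕ i ℕ.+ c ℕ.* K

  class-near : ∀ i {c d} → class i c ℕ.≤ class i d → class i d ℕ.< class i c ℕ.+ K → c ≡ d
  class-near i {c} {d} le lt = ℕₚ.≤-antisym
    (ℕₚ.*-cancelʳ-≤ c d K (ℕₚ.+-cancelˡ-≤ (toℕ i) _ _ le))
    (ℕₚ.≤-pred (ℕₚ.*-cancelʳ-< K d (suc c) (ℕₚ.+-cancelˡ-< (toℕ i) _ _
      (ℕₚ.<-≤-trans lt (ℕₚ.≤-reflexive (trans (ℕₚ.+-assoc (toℕ i) _ K) (cong (toℕ i ℕ.+_) (ℕₚ.+-comm _ K))))))))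

  class-injective : ∀ i j {c d} → class i c ≡ class j d → i ≡ j
  class-injective i j {c} {d} eq = toℕ-injective (trans (sym (residue i c)) (trans (cong (_% K) eq) (residue j d)))
    where
    residue : ∀ i c → class i c % K ≡ toℕ i
    residue i c = trans ([m+kn]%n≡m%n (toℕ i) c K) (m<n⇒m%n≡m (toℕ<n i))

  class-surjective : ∀ a → ∃ λ i → ∃ λ c → a ≡ class i c
  class-surjective a = fromℕ< (m%n<n a K) , a / K ,
    trans (m≡m%n+[m/n]*n a K) (cong (ℕ._+ a / K ℕ.* K) (sym (toℕ-fromℕ< (m%n<n a K))))

  record Residue (x : Carrier) (i : Fin K) : Set where
    constructor residue
    field
      quotient : ℕ
      index : Index x (class i quotient)
  open Residue

  residue-exists : ∀ {x a} → Index x a → ∃ (Residue x)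
  residue-exists {x} {a} ix with class-surjective a
  ... | i , c , a≡ = i , residue c (subst (Index x) a≡ ix)

  sandwiched : ∀ {x y z i j} (rx : Residue x i) (rz : Residue z i) → Residue y j →
    quotient rx ≡ quotient rz → x ≤ y → y ≤ z → j ≡ i
  sandwiched {z = z} {i} {j} (residue c ix) (residue c′ iz) (residue d iy) c≡c′ x≤y y≤z =
    class-injective j i {d} {c} (ℕₚ.≤-antisym (index-mono iy iz′ y≤z) (index-mono ix iy x≤y))
    where
    iz′ : Index z (class i c)
    iz′ = subst (λ c → Index z (class i c)) (sym c≡c′) iz

  -- A ratio below `q^ n` keeps the indices less than `K` apart, and congruent indices that close
  -- are equal.
  same-quotient : ∀ {x y i} (rx : Residue x i) (ry : Residue y i) → x ≤ y → y < q^ n * x →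
    quotient rx ≡ quotient ry
  same-quotient {i = i} (residue c ix) (residue d iy) x≤y near =
    class-near i {c} {d} (index-mono ix iy x≤y) (index-near ix iy near)

  scale : ℕ → Carrier
  scale b = q^ (K ℕ.* b)

  0<scale : ∀ b → 0# < scale b
  0<scale b = 0<q^ (K ℕ.* b)

  -- Multiplying x by a power of q^K avoids negative exponents.
  record LogClass (x : Carrier) (i : Fin K) : Set where
    constructor logClass
    field
      exponent : ℕ
      scaled : Residue (x * scale exponent) i
  open LogClass

  -- Scaling by a power that exceeds the inverse of `x` brings the point above 1, where an index
  -- exists. Both bounding powers come from the Archimedean property, hence the double negation.
  logClass-exists : ∀ {x} → 0# < x → ¬ ¬ ∃ (LogClass x)
  logClass-exists {x} 0<x none with inverse x (λ x≡0 → <-irrefl (sym x≡0) 0<x)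
  ... | y , xy≡1 = q^-unbounded y λ (b , y<) → q^-unbounded (x * scale b) λ (m , lt) →
    let i , r = residue-exists (proj₂ (index-exists (1≤ b y<) m lt)) in none (i , logClass b r)
    where
    1≤ : ∀ b → y < q^ b → 1# ≤ x * scale b
    -- `scale b` dominates `q^ b` because `K * b = b + n * b`.
    1≤ b y< = subst (_≤ x * scale b) xy≡1 (<⇒≤ (*-monoˡ-< x 0<x (<-≤-trans y< (q^-mono (ℕₚ.m≤m+n b (n ℕ.* b))))))

  class-+ : ∀ i c e → class i c ℕ.+ K ℕ.* e ≡ class i (c ℕ.+ e)
  class-+ i c e = trans (ℕₚ.+-assoc (toℕ i) _ _) (cong (toℕ i ℕ.+_)
    (trans (cong (c ℕ.* K ℕ.+_) (ℕₚ.*-comm K e)) (sym (ℕₚ.*-distribʳ-+ K c e))))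

  -- A further factor `scale e` raises the index by `K * e` and so preserves its residue. This lets
  -- several points be compared at one common scale.
  scaled-at : ∀ {x i} (l : LogClass x i) {B} → exponent l ℕ.≤ B → Residue (x * scale B) i
  scaled-at {x} {i} (logClass b (residue c ix)) {B} b≤B = residue (c ℕ.+ e)
    (subst₂ Index same-scale (class-+ i c e) (index-scale (K ℕ.* e) ix))
    where
    e = B ℕ.∸ b
    same-scale : x * scale b * q^ (K ℕ.* e) ≡ x * scale B
    same-scale = trans (*-assoc x _ _) (cong (x *_) (trans (sym (q^-+ (K ℕ.* b) (K ℕ.* e)))
      (cong q^ (trans (sym (ℕₚ.*-distribˡ-+ K b e)) (cong (K ℕ.*_) (ℕₚ.m+[n∸m]≡n b≤B))))))

  logClass-unique : ∀ {x i j} → LogClass x i → LogClass x j → j ≡ i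
  logClass-unique {x} {i} l l′ = sandwiched r r
    (scaled-at l′ (ℕₚ.m≤n+m (exponent l′) (exponent l))) refl ≤-refl ≤-refl
    where
    r : Residue (x * scale (exponent l ℕ.+ exponent l′)) i
    r = scaled-at l (ℕₚ.m≤m+n (exponent l) (exponent l′))

  -- Four points of a homothetic copy

  record Spaced (δ p₁ p₂ p₃ p₄ : Carrier) : Set where
    field
      0<δ : 0# < δ
      gap₁ : p₁ + δ ≤ p₂
      gap₂ : p₂ + δ ≤ p₃
      gap₃ : p₃ + δ ≤ p₄
      spread : p₄ ≤ p₁ + ι M * δ

    1<2 : p₁ < p₂
    1<2 = <-≤-trans (x<x+e 0<δ) gap₁
    2<3 : p₂ < p₃
    2<3 = <-≤-trans (x<x+e 0<δ) gap₂
    3<4 : p₃ < p₄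
    3<4 = <-≤-trans (x<x+e 0<δ) gap₃
    1<4 : p₁ < p₄
    1<4 = <-trans 1<2 (<-trans 2<3 3<4)

    -- Since `p₁` is positive, `δ` is smaller than `p₂`; so `p₄` is less than `(1# + ι M) * p₂`.
    near : 0# < p₁ → p₄ < q^ n * p₂
    near 0<p₁ = begin-strict
      p₄                 ≤⟨ spread ⟩
      p₁ + ι M * δ       <⟨ +-mono-< 1<2 (*-monoˡ-< (ι M) 0<ιM δ<p₂) ⟩
      p₂ + ι M * p₂      ≡⟨ solve 2 (λ m p → p :+ m :* p := (con 1 :+ m) :* p) refl (ι M) p₂ ⟩
      (1# + ι M) * p₂    ≤⟨ *-monoʳ-≤ p₂ (<-trans 0<p₁ 1<2) 1+M≤q^n ⟩
      q^ n * p₂          ∎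
      where
      δ<p₂ : δ < p₂
      δ<p₂ = <-≤-trans (subst (δ <_) (+-comm δ p₁) (x<x+e 0<p₁)) gap₁

  spaced-scale : ∀ {δ p₁ p₂ p₃ p₄} s → 0# < s → Spaced δ p₁ p₂ p₃ p₄ →
    Spaced (δ * s) (p₁ * s) (p₂ * s) (p₃ * s) (p₄ * s)
  spaced-scale {δ} {p₁} {p₄ = p₄} s 0<s sp = record
    { 0<δ = *-pos 0<δ 0<s
    ; gap₁ = gap gap₁ ; gap₂ = gap gap₂ ; gap₃ = gap gap₃
    ; spread = subst (p₄ * s ≤_) (solve 4 (λ p m δ s → (p :+ m :* δ) :* s := p :* s :+ m :* (δ :* s)) refl p₁ (ι M) δ s)
        (*-monoʳ-≤ s 0<s spread) }
    where
    open Spaced sp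
    gap : ∀ {x y} → x + δ ≤ y → x * s + δ * s ≤ y * s
    gap {x} {y} le = subst (_≤ y * s) (solve 3 (λ x d s → (x :+ d) :* s := x :* s :+ d :* s) refl x δ s) (*-monoʳ-≤ s 0<s le)

  -- Reflection exchanges the second and third points, so each of the two positive cases also serves
  -- the other case on the negative half-line.
  spaced-neg : ∀ {δ p₁ p₂ p₃ p₄} → Spaced δ p₁ p₂ p₃ p₄ → Spaced δ (- p₄) (- p₃) (- p₂) (- p₁)
  spaced-neg {δ} sp = record
    { 0<δ = 0<δ ; gap₁ = flip gap₃ ; gap₂ = flip gap₂ ; gap₃ = flip gap₁ ; spread = flip′ spread }
    where
    open Spaced sp
    move : ∀ x y z → - y + (x + y + z) ≡ x + z
    move x y z = trans (solve 4 (λ n x y z → n :+ (x :+ y :+ z) := (x :+ z) :+ (n :+ y)) refl (- y) x y z)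
      (trans (cong (x + z +_) (-‿inverseˡ y)) (+-identityʳ _))
    flip : ∀ {x y e} → x + e ≤ y → - y + e ≤ - x
    flip {x} {y} {e} le = subst₂ _≤_ left right (+-monoʳ-≤ (- x + - y) le)
      where
      left : - x + - y + (x + e) ≡ - y + e
      left = trans (solve 4 (λ n m x e → n :+ m :+ (x :+ e) := (m :+ e) :+ (n :+ x)) refl (- x) (- y) x e)
        (trans (cong (- y + e +_) (-‿inverseˡ x)) (+-identityʳ _))
      right : - x + - y + y ≡ - x
      right = trans (+-assoc _ _ _) (trans (cong (- x +_) (-‿inverseˡ y)) (+-identityʳ _))
    flip′ : ∀ {x y e} → y ≤ x + e → - x ≤ - y + e
    flip′ {x} {y} {e} le = subst₂ _≤_ left right (+-monoʳ-≤ (- x + - y) le)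
      where
      left : - x + - y + y ≡ - x
      left = trans (+-assoc _ _ _) (trans (cong (- x +_) (-‿inverseˡ y)) (+-identityʳ _))
      right : - x + - y + (x + e) ≡ - y + e
      right = trans (solve 4 (λ n m x e → n :+ m :+ (x :+ e) := (m :+ e) :+ (n :+ x)) refl (- x) (- y) x e)
        (trans (cong (- y + e +_) (-‿inverseˡ x)) (+-identityʳ _))

  -- By `near`, `p₂` and `p₄` lie in one interval, and `p₃` lies between them.
  residue-third : ∀ {δ p₁ p₂ p₃ p₄ i j} → 0# < p₁ → Spaced δ p₁ p₂ p₃ p₄ →
    Residue p₂ i → Residue p₃ j → Residue p₄ i → j ≡ i
  residue-third 0<p₁ sp r₂ r₃ r₄ = sandwiched r₂ r₄ r₃
    (same-quotient r₂ r₄ (<⇒≤ (<-trans 2<3 3<4)) (near 0<p₁)) (<⇒≤ 2<3) (<⇒≤ 3<4)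
    where open Spaced sp

  -- Sharing an interval forces `δ < κ * p₃`, that is `ι N * δ < p₃`. As `N = M + M`, doubling
  -- `p₃ ≤ p₁ + ι M * δ` and cancelling one `p₃` gives `p₃` less than twice `p₁`.
  close-third : ∀ {δ p₁ p₂ p₃ p₄ a} → Spaced δ p₁ p₂ p₃ p₄ → 0# < p₁ →
    Index p₃ a → Index p₄ a → p₃ < q^ n * p₁
  close-third {δ} {p₁} {p₂} {p₃} {p₄} {a} sp 0<p₁ i₃ i₄ = +-cancelʳ-< p₃ (begin-strict
      p₃ + p₃                          ≤⟨ +-mono-≤ p₃≤ p₃≤ ⟩
      p₁ + ι M * δ + (p₁ + ι M * δ)    ≡⟨ solve 3 (λ p m d → p :+ m :* d :+ (p :+ m :* d) := (con 1 :+ con 1) :* p :+ (m :+ m) :* d) refl p₁ (ι M) δ ⟩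
      (1# + 1#) * p₁ + (ι M + ι M) * δ ≡⟨ cong (λ x → (1# + 1#) * p₁ + x * δ) (sym ιN≡) ⟩
      (1# + 1#) * p₁ + ι N * δ         <⟨ +-monoʳ-< _ Nδ<p₃ ⟩
      (1# + 1#) * p₁ + p₃              ≤⟨ +-monoˡ-≤ p₃ (*-monoʳ-≤ p₁ 0<p₁ (≤-trans (+-monoʳ-≤ 1# (1≤ι 1≤M)) 1+M≤q^n)) ⟩
      q^ n * p₁ + p₃                   ∎)
    where
    open Spaced sp
    δ<κp₃ : δ < κ * p₃
    δ<κp₃ = +-cancelʳ-< p₃ (begin-strict
      δ + p₃            ≡⟨ +-comm δ p₃ ⟩
      p₃ + δ            ≤⟨ gap₃ ⟩
      p₄                <⟨ Index.upper i₄ ⟩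
      q^ (suc a)        ≤⟨ *-monoˡ-≤ q 0<q (Index.lower i₃) ⟩
      q * p₃            ≡⟨ solve 2 (λ κ p → (con 1 :+ κ) :* p := κ :* p :+ p) refl κ p₃ ⟩
      κ * p₃ + p₃       ∎)
    Nδ<p₃ : ι N * δ < p₃
    Nδ<p₃ = begin-strict
      ι N * δ           <⟨ *-monoˡ-< (ι N) 0<ιN δ<κp₃ ⟩
      ι N * (κ * p₃)    ≡⟨ sym (*-assoc _ _ _) ⟩
      ι N * κ * p₃      ≡⟨ cong (_* p₃) Nκ≡1 ⟩
      1# * p₃           ≡⟨ *-identityˡ p₃ ⟩
      p₃                ∎
    p₃≤ : p₃ ≤ p₁ + ι M * δ
    p₃≤ = ≤-trans (<⇒≤ 3<4) spread

  -- First `p₃` and `p₄` are seen to share an interval; then `close-third` puts `p₁` into it, and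
  -- `p₂` lies between `p₁` and `p₃`.
  residue-second : ∀ {δ p₁ p₂ p₃ p₄ i j} → 0# < p₁ → Spaced δ p₁ p₂ p₃ p₄ →
    Residue p₁ i → Residue p₂ j → Residue p₃ i → Residue p₄ i → j ≡ i
  residue-second {p₄ = p₄} {i} 0<p₁ sp r₁ r₂ r₃ r₄ = sandwiched r₁ r₃ r₂
    (same-quotient r₁ r₃ (<⇒≤ (<-trans 1<2 2<3)) (close-third sp 0<p₁ (index r₃) i₄)) (<⇒≤ 1<2) (<⇒≤ 2<3)
    where
    open Spaced sp
    i₄ : Index p₄ (class i (quotient r₃))
    i₄ = subst (λ c → Index p₄ (class i c))
      (sym (same-quotient r₃ r₄ (<⇒≤ 3<4) (<-trans (near 0<p₁) (*-monoˡ-< (q^ n) (0<q^ n) 2<3)))) (index r₄)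

  logClass-third : ∀ {δ p₁ p₂ p₃ p₄ i j} → 0# < p₁ → Spaced δ p₁ p₂ p₃ p₄ →
    LogClass p₂ i → LogClass p₃ j → LogClass p₄ i → j ≡ i
  logClass-third 0<p₁ sp l₂ l₃ l₄ = residue-third (*-pos 0<p₁ (0<scale B)) (spaced-scale (scale B) (0<scale B) sp)
      (scaled-at l₂ (ℕₚ.≤-trans (ℕₚ.m≤m+n b₂ b₃) (ℕₚ.m≤m+n _ b₄)))
      (scaled-at l₃ (ℕₚ.≤-trans (ℕₚ.m≤n+m b₃ b₂) (ℕₚ.m≤m+n _ b₄)))
      (scaled-at l₄ (ℕₚ.m≤n+m b₄ (b₂ ℕ.+ b₃)))
    where
    b₂ = exponent l₂
    b₃ = exponent l₃
    b₄ = exponent l₄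
    B = b₂ ℕ.+ b₃ ℕ.+ b₄

  logClass-second : ∀ {δ p₁ p₂ p₃ p₄ i j} → 0# < p₁ → Spaced δ p₁ p₂ p₃ p₄ →
    LogClass p₁ i → LogClass p₂ j → LogClass p₃ i → LogClass p₄ i → j ≡ i
  logClass-second 0<p₁ sp l₁ l₂ l₃ l₄ = residue-second (*-pos 0<p₁ (0<scale B)) (spaced-scale (scale B) (0<scale B) sp)
      (scaled-at l₁ (ℕₚ.≤-trans (ℕₚ.m≤m+n b₁ b₂) (ℕₚ.m≤m+n _ _)))
      (scaled-at l₂ (ℕₚ.≤-trans (ℕₚ.m≤n+m b₂ b₁) (ℕₚ.m≤m+n _ _)))
      (scaled-at l₃ (ℕₚ.≤-trans (ℕₚ.m≤m+n b₃ b₄) (ℕₚ.m≤n+m _ (b₁ ℕ.+ b₂))))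
      (scaled-at l₄ (ℕₚ.≤-trans (ℕₚ.m≤n+m b₄ b₃) (ℕₚ.m≤n+m _ (b₁ ℕ.+ b₂))))
    where
    b₁ = exponent l₁
    b₂ = exponent l₂
    b₃ = exponent l₃
    b₄ = exponent l₄
    B = b₁ ℕ.+ b₂ ℕ.+ (b₃ ℕ.+ b₄)

  -- Progressions leave their residue class

  short-step : ∀ {p t s a} → 0# < s → t < κ * p → p * s < q^ a → (p + t) * s < q^ (suc a)
  short-step {p} {t} {s} {a} 0<s t<κp ps< = begin-strict
    (p + t) * s        <⟨ *-monoʳ-< s 0<s (+-monoʳ-< p t<κp) ⟩
    (p + κ * p) * s    ≡⟨ solve 3 (λ p κ s → (p :+ κ :* p) :* s := (con 1 :+ κ) :* (p :* s)) refl p κ s ⟩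
    q * (p * s)        <⟨ *-monoˡ-< q 0<q ps< ⟩
    q^ (suc a)         ∎

  -- From term `N` on, each step multiplies by less than `q`, so the progression cannot jump over an
  -- interval. Staying in one residue class it would never enter the next interval, and so would be
  -- bounded.
  logClass-apFree : ∀ x t i → 0# < x → 0# < t → ¬ (∀ m → ¬ ¬ LogClass (x + ι m * t) i)
  logClass-apFree x t i 0<x 0<t same = same N λ l → bounded⇒⊥ (exponent l) (scaled l)
    where
    point : ℕ → Carrier
    point m = x + ι (N ℕ.+ m) * t
    point-suc : ∀ m → point (suc m) ≡ point m + t
    point-suc m = trans (cong (λ k → x + ι k * t) (ℕₚ.+-suc N m))
      (solve 3 (λ x a t → x :+ (con 1 :+ a) :* t := x :+ a :* t :+ t) refl x (ι (N ℕ.+ m)) t)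
    point-zero : x + ι N * t ≡ point 0
    point-zero = cong (λ k → x + ι k * t) (sym (ℕₚ.+-identityʳ N))
    0<point₀ : 0# < x + ι N * t
    0<point₀ = <-≤-trans 0<x (x≤x+e (<⇒≤ (*-pos 0<ιN 0<t)))
    start≤ : ∀ m → point 0 ≤ point m
    start≤ zero = ≤-refl
    start≤ (suc m) = subst (point 0 ≤_) (sym (point-suc m)) (≤-trans (start≤ m) (<⇒≤ (x<x+e 0<t)))
    t<κpoint : t < κ * point 0
    -- Starting at term `N` works because `ι N * κ` is 1.
    t<κpoint = begin-strict
      t                      ≡⟨ sym (*-identityˡ t) ⟩
      1# * t                 ≡⟨ cong (_* t) (sym Nκ≡1) ⟩
      ι N * κ * t            ≡⟨ solve 3 (λ N κ t → N :* κ :* t := κ :* (N :* t)) refl (ι N) κ t ⟩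
      κ * (ι N * t)          <⟨ *-monoˡ-< κ 0<κ (subst (ι N * t <_) (+-comm _ x) (x<x+e 0<x)) ⟩
      κ * (x + ι N * t)      ≡⟨ cong (κ *_) point-zero ⟩
      κ * point 0            ∎
    bounded⇒⊥ : ∀ b → Residue ((x + ι N * t) * scale b) i → ⊥
    bounded⇒⊥ b (residue c ix) = archimedean (q^ (suc u)) (t * s) (*-pos 0<t 0<s) λ (m , lt) →
      <⇒≱ (<-trans lt (large m)) (<⇒≤ (below m))
      where
      s = scale b
      u = class i c
      0<s : 0# < s
      0<s = 0<scale b
      large : ∀ m → ι m * (t * s) < point m * s
      large m = begin-strict
        ι m * (t * s)                     <⟨ x<x+e (*-pos 0<point₀ 0<s) ⟩
        ι m * (t * s) + (x + ι N * t) * s ≡⟨ solve 5 (λ m t s x N → m :* (t :* s) :+ (x :+ N :* t) :* s := (x :+ (N :+ m) :* t) :* s) refl (ι m) t s x (ι N) ⟩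
        (x + (ι N + ι m) * t) * s         ≡⟨ cong (λ k → (x + k * t) * s) (sym (ι-+ N m)) ⟩
        point m * s                       ∎
      step : ∀ m → point m * s < q^ (suc u) → point (suc m) * s < q^ (suc (suc u))
      step m lt = subst (λ y → y * s < q^ (suc (suc u))) (sym (point-suc m))
        (short-step {a = suc u} 0<s (<-≤-trans t<κpoint (*-monoˡ-≤ κ 0<κ (start≤ m))) lt)
      -- Consecutive indices have different residues because `K` is at least 2, by `1≤n`.
      wrong-class : ∀ j d → suc u ≡ class j d → j ≢ i
      wrong-class j d eq refl = ℕₚ.1+n≢n (trans eq (cong (class i) (sym c≡d)))
        where
        c≡d : c ≡ d
        c≡d = class-near i {c} {d} (ℕₚ.≤-trans (ℕₚ.n≤1+n u) (ℕₚ.≤-reflexive eq))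
          (ℕₚ.≤-<-trans (ℕₚ.≤-reflexive (trans (sym eq) (ℕₚ.+-comm 1 u))) (ℕₚ.+-monoʳ-< u (s≤s 1≤n)))
      next-class⇒⊥ : ∀ m → Index (point (suc m) * s) (suc u) → ⊥
      next-class⇒⊥ m iy with class-surjective (suc u)
      ... | j , d , 1+u≡ = same (N ℕ.+ suc m) λ l →
        wrong-class j d 1+u≡ (logClass-unique l (logClass b (residue d (subst (Index _) 1+u≡ iy))))
      below : ∀ m → point m * s < q^ (suc u)
      below zero = subst (λ y → y * s < q^ (suc u)) point-zero (Index.upper ix)
      below (suc m) with <-or-≥ (point (suc m) * s) (q^ (suc u))
      ... | inj₁ lt = lt
      ... | inj₂ above = ⊥-elim (next-class⇒⊥ m (within above (step m (below m))))

  -- The colouring of the field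

  abstract
    -- There are finitely many residues, so `weakChoice` can pick one. The default `zero` for points
    -- that are not positive is harmless, as `code` consults `L` only at positive arguments.
    logColour : ∀ x → ∃ λ i → 0# < x → ¬ ¬ LogClass x i
    logColour x = choose (<-or-≥ 0# x)
      where
      choose : 0# < x ⊎ x ≤ 0# → ∃ λ i → 0# < x → ¬ ¬ LogClass x i
      choose (inj₂ x≤0) = zero , λ 0<x → ⊥-elim (<⇒≱ 0<x x≤0)
      choose (inj₁ 0<x) = let i , ¬¬l = weakChoice K (LogClass x) (logClass-exists 0<x) in i , λ _ → ¬¬l

  L : Carrier → Fin K
  L x = proj₁ (logColour x)

  -- Zero has a sign of its own, so no other point shares its colour.
  code : Carrier → Fin 3 × Fin K
  code x with compare 0# x
  ... | tri< _ _ _ = zero , L x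
  ... | tri≈ _ _ _ = suc zero , zero
  ... | tri> _ _ _ = suc (suc zero) , L (- x)

  colouring : Carrier → Fin (3 ℕ.* K)
  colouring x = combine (proj₁ (code x)) (proj₂ (code x))

  0<neg : ∀ {x} → x < 0# → 0# < - x
  0<neg {x} x<0 = subst₂ _<_ (-‿inverseʳ x) (+-identityˡ (- x)) (+-monoˡ-< (- x) x<0)

  data SameColour (x y : Carrier) : Set where
    positive : 0# < x → 0# < y → L x ≡ L y → SameColour x y
    vanish   : x ≡ y → SameColour x y
    negative : x < 0# → y < 0# → L (- x) ≡ L (- y) → SameColour x y

  sameColour : ∀ x y → code x ≡ code y → SameColour x y
  sameColour x y eq with compare 0# x | compare 0# y
  ... | tri< 0<x _ _ | tri< 0<y _ _ = positive 0<x 0<y (cong proj₂ eq)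
  ... | tri≈ _ 0≡x _ | tri≈ _ 0≡y _ = vanish (trans (sym 0≡x) 0≡y)
  ... | tri> _ _ x<0 | tri> _ _ y<0 = negative x<0 y<0 (cong proj₂ eq)
  ... | tri< _ _ _ | tri≈ _ _ _ with () ← eq
  ... | tri< _ _ _ | tri> _ _ _ with () ← eq
  ... | tri≈ _ _ _ | tri< _ _ _ with () ← eq
  ... | tri≈ _ _ _ | tri> _ _ _ with () ← eq
  ... | tri> _ _ _ | tri< _ _ _ with () ← eq
  ... | tri> _ _ _ | tri≈ _ _ _ with () ← eq

  colouring-≡ : ∀ x y → colouring x ≡ colouring y → SameColour x y
  colouring-≡ x y eq = sameColour x y
    (let s , l = combine-injective (proj₁ (code x)) (proj₂ (code x)) (proj₁ (code y)) (proj₂ (code y)) eq in cong₂ _,_ s l)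

  code-positive : ∀ {x} → 0# < x → code x ≡ (zero , L x)
  code-positive {x} 0<x with compare 0# x
  ... | tri< _ _ _ = refl
  ... | tri≈ ≮ _ _ = ⊥-elim (≮ 0<x)
  ... | tri> ≮ _ _ = ⊥-elim (≮ 0<x)

  code-negative : ∀ {x} → x < 0# → code x ≡ (suc (suc zero) , L (- x))
  code-negative {x} x<0 with compare 0# x
  ... | tri< _ _ ≯ = ⊥-elim (≯ x<0)
  ... | tri≈ _ _ ≯ = ⊥-elim (≯ x<0)
  ... | tri> _ _ _ = refl

  colouring-positive : ∀ {x y} → 0# < x → 0# < y → L x ≡ L y → colouring x ≡ colouring y
  colouring-positive 0<x 0<y eq = cong (λ c → combine (proj₁ c) (proj₂ c))
    (trans (code-positive 0<x) (trans (cong (zero ,_) eq) (sym (code-positive 0<y))))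

  colouring-negative : ∀ {x y} → x < 0# → y < 0# → L (- x) ≡ L (- y) → colouring x ≡ colouring y
  colouring-negative x<0 y<0 eq = cong (λ c → combine (proj₁ c) (proj₂ c))
    (trans (code-negative x<0) (trans (cong (suc (suc zero) ,_) eq) (sym (code-negative y<0))))

  class-of : ∀ x {i} → 0# < x → L x ≡ i → ¬ ¬ LogClass x i
  class-of x 0<x refl = proj₂ (logColour x) 0<x

  -- Equality of colours is decidable, hence stable, so the double-negated classes may be used as if
  -- they were given.
  L-third : ∀ {δ p₁ p₂ p₃ p₄} → 0# < p₁ → Spaced δ p₁ p₂ p₃ p₄ → L p₂ ≡ L p₄ → L p₃ ≡ L p₄
  L-third {p₂ = p₂} {p₃} {p₄} 0<p₁ sp eq = decidable-stable (_ Finₚ.≟ _) λ differ →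
    class-of p₂ 0<p₂ eq λ l₂ → class-of p₃ 0<p₃ refl λ l₃ → class-of p₄ (<-trans 0<p₃ 3<4) refl λ l₄ →
      differ (logClass-third 0<p₁ sp l₂ l₃ l₄)
    where
    open Spaced sp
    0<p₂ = <-trans 0<p₁ 1<2
    0<p₃ = <-trans 0<p₂ 2<3

  L-second : ∀ {δ p₁ p₂ p₃ p₄} → 0# < p₁ → Spaced δ p₁ p₂ p₃ p₄ → L p₁ ≡ L p₄ → L p₃ ≡ L p₄ → L p₂ ≡ L p₄
  L-second {p₁ = p₁} {p₂} {p₃} {p₄} 0<p₁ sp eq₁ eq₃ = decidable-stable (_ Finₚ.≟ _) λ differ →
    class-of p₁ 0<p₁ eq₁ λ l₁ → class-of p₂ 0<p₂ refl λ l₂ → class-of p₃ 0<p₃ eq₃ λ l₃ →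
      class-of p₄ (<-trans 0<p₃ 3<4) refl λ l₄ → differ (logClass-second 0<p₁ sp l₁ l₂ l₃ l₄)
    where
    open Spaced sp
    0<p₂ = <-trans 0<p₁ 1<2
    0<p₃ = <-trans 0<p₂ 2<3

  -- Equal colours of distinct points give them one sign. On the negative side the reflected copy
  -- has `- p₃` in second place, so `L-second` applies.
  colouring-third : ∀ {δ p₁ p₂ p₃ p₄} → Spaced δ p₁ p₂ p₃ p₄ →
    colouring p₁ ≡ colouring p₄ → colouring p₂ ≡ colouring p₄ → colouring p₃ ≡ colouring p₄
  colouring-third {p₁ = p₁} {p₂} {p₃} {p₄} sp c₁ c₂ with colouring-≡ p₁ p₄ c₁ | colouring-≡ p₂ p₄ c₂
  ... | vanish refl | _ = ⊥-elim (<-irrefl refl (Spaced.1<4 sp))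
  ... | _ | vanish refl = ⊥-elim (<-asym (Spaced.2<3 sp) (Spaced.3<4 sp))
  ... | positive _ 0<p₄ _ | negative _ p₄<0 _ = ⊥-elim (<-asym 0<p₄ p₄<0)
  ... | negative _ p₄<0 _ | positive _ 0<p₄ _ = ⊥-elim (<-asym 0<p₄ p₄<0)
  ... | positive 0<p₁ 0<p₄ _ | positive 0<p₂ _ eq =
    colouring-positive (<-trans 0<p₂ (Spaced.2<3 sp)) 0<p₄ (L-third 0<p₁ sp eq)
  ... | negative p₁<0 p₄<0 eq₁ | negative p₂<0 _ eq₂ =
    colouring-negative (<-trans (Spaced.3<4 sp) p₄<0) p₄<0
      (trans (L-second (0<neg p₄<0) (spaced-neg sp) (sym eq₁) (trans eq₂ (sym eq₁))) eq₁)

  colouring-second : ∀ {δ p₁ p₂ p₃ p₄} → Spaced δ p₁ p₂ p₃ p₄ →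
    colouring p₁ ≡ colouring p₄ → colouring p₃ ≡ colouring p₄ → colouring p₂ ≡ colouring p₄
  colouring-second {p₁ = p₁} {p₂} {p₃} {p₄} sp c₁ c₃ with colouring-≡ p₁ p₄ c₁ | colouring-≡ p₃ p₄ c₃
  ... | vanish refl | _ = ⊥-elim (<-irrefl refl (Spaced.1<4 sp))
  ... | _ | vanish refl = ⊥-elim (<-irrefl refl (Spaced.3<4 sp))
  ... | positive _ 0<p₄ _ | negative _ p₄<0 _ = ⊥-elim (<-asym 0<p₄ p₄<0)
  ... | negative _ p₄<0 _ | positive _ 0<p₄ _ = ⊥-elim (<-asym 0<p₄ p₄<0)
  ... | positive 0<p₁ 0<p₄ eq₁ | positive 0<p₃ _ eq₃ =
    colouring-positive (<-trans 0<p₁ (Spaced.1<2 sp)) 0<p₄ (L-second 0<p₁ sp eq₁ eq₃)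
  ... | negative p₁<0 p₄<0 eq₁ | negative p₃<0 _ eq₃ =
    colouring-negative p₂<0 p₄<0 (trans (L-third (0<neg p₄<0) (spaced-neg sp) (trans eq₃ (sym eq₁))) eq₁)
    where
    p₂<0 : p₂ < 0#
    p₂<0 = <-trans (Spaced.2<3 sp) p₃<0

  -- After finitely many terms the progression has the sign of `t`. That tail, negated when `t` is
  -- negative, is a positive progression with positive step in one class.
  colouring-apFree : APFreeℝ R colouring
  colouring-apFree (a , t , t≢0 , same) with compare 0# t
  ... | tri≈ _ 0≡t _ = t≢0 (sym 0≡t)
  ... | tri< 0<t _ _ = archimedean (- a) t 0<t λ (m , lt) →
    let x = a + ι m * t
        0<x : 0# < x
        0<x = subst (_< x) (-‿inverseʳ a) (+-monoʳ-< a lt)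
        point≡ : ∀ k → a + ι (m ℕ.+ k) * t ≡ x + ι k * t
        point≡ k = trans (cong (λ y → a + y * t) (ι-+ m k))
          (solve 4 (λ a m k t → a :+ (m :+ k) :* t := a :+ m :* t :+ k :* t) refl a (ι m) (ι k) t)
        0<point : ∀ k → 0# < x + ι k * t
        0<point = λ where
          zero → subst (0# <_) (sym (trans (cong (x +_) (zeroˡ t)) (+-identityʳ x))) 0<x
          (suc k) → <-trans 0<x (x<x+e (*-pos (0<ι-suc k) 0<t))
    in logClass-apFree x t (L x) 0<x 0<t λ k →
      class-of (x + ι k * t) (0<point k) (positive-L (0<point k)
        (colouring-≡ (x + ι k * t) x (trans (trans (cong colouring (sym (point≡ k))) (same (m ℕ.+ k))) (sym (same m)))))
    where
    positive-L : ∀ {x y} → 0# < x → SameColour x y → L x ≡ L y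
    positive-L _ (positive _ _ eq) = eq
    positive-L _ (vanish refl) = refl
    positive-L 0<x (negative x<0 _ _) = ⊥-elim (<-asym 0<x x<0)
  ... | tri> _ _ t<0 = archimedean a (- t) (0<neg t<0) λ (m , lt) →
    let x = - a + ι m * - t
        0<x : 0# < x
        0<x = subst (_< x) (-‿inverseˡ a) (+-monoʳ-< (- a) lt)
        neg : ∀ k → - (a + ι k * t) ≡ - a + ι k * - t
        neg k = neg-unique (trans (solve 5 (λ a k t n m → (n :+ k :* m) :+ (a :+ k :* t) := (n :+ a) :+ k :* (m :+ t)) refl a (ι k) t (- a) (- t))
          (trans (cong₂ (λ u v → u + ι k * v) (-‿inverseˡ a) (-‿inverseˡ t)) (trans (+-identityˡ _) (zeroʳ _))))
        point≡ : ∀ k → - (a + ι (m ℕ.+ k) * t) ≡ x + ι k * - t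
        point≡ k = trans (neg (m ℕ.+ k)) (trans (cong (λ y → - a + y * - t) (ι-+ m k))
          (solve 4 (λ a m k t → a :+ (m :+ k) :* t := a :+ m :* t :+ k :* t) refl (- a) (ι m) (ι k) (- t)))
        0<point : ∀ k → 0# < x + ι k * - t
        0<point = λ where
          zero → subst (0# <_) (sym (trans (cong (x +_) (zeroˡ (- t))) (+-identityʳ x))) 0<x
          (suc k) → <-trans 0<x (x<x+e (*-pos (0<ι-suc k) (0<neg t<0)))
    in logClass-apFree x (- t) (L x) 0<x (0<neg t<0) λ k →
      class-of (x + ι k * - t) (0<point k)
        (trans (cong L (sym (point≡ k))) (trans (negative-L (subst (0# <_) (sym (point≡ k)) (0<point k))
          (colouring-≡ _ _ (trans (same (m ℕ.+ k)) (sym (same m))))) (cong L (neg m))))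
    where
    neg-unique : ∀ {x y} → y + x ≡ 0# → - x ≡ y
    neg-unique {x} {y} eq = trans (sym (+-identityˡ _)) (trans (cong (_+ - x) (sym eq)) (cancel-right y x))
    negative-L : ∀ {x y} → 0# < - x → SameColour x y → L (- x) ≡ L (- y)
    negative-L _ (negative _ _ eq) = eq
    negative-L _ (vanish refl) = refl
    negative-L {x} 0<-x (positive 0<x _ _) = ⊥-elim (<-irrefl refl
      (subst (0# <_) (-‿inverseʳ x) (<-trans 0<x (x<x+e 0<-x))))

-- Homothetic copies of S

lookup-distinct : ∀ {xs : List ℤ} → Unique xs → ∀ {i j} → i Fin.< j → lookup xs i ≢ lookup xs j
lookup-distinct (x≢ ∷ _) {zero} {suc j} _ = All.lookup x≢ (∈-lookup j)
lookup-distinct (_ ∷ unique) {suc i} {suc j} (s≤s i<j) = lookup-distinct unique i<j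

unique-⊆⇒length-≤ : ∀ {xs ys : List ℤ} → Unique xs → (∀ {x} → x ∈ xs → x ∈ ys) → length xs ℕ.≤ length ys
unique-⊆⇒length-≤ {xs} {ys} unique sub = ℕₚ.≮⇒≥ λ lt →
  let i , j , i<j , eq = pigeonhole lt (λ i → Any.index (sub (∈-lookup i)))
  in lookup-distinct unique i<j (trans (lookup-index (sub (∈-lookup i)))
       (trans (cong (lookup ys) eq) (sym (lookup-index (sub (∈-lookup j))))))

member-outside : ∀ {S : List ℤ} → Unique S → ∀ ys → length ys ℕ.< length S → ∃ λ w → w ∈ S × w ∉ ys
member-outside {S} unique ys short with All.all? (_∈? ys) S
... | yes all = ⊥-elim (ℕₚ.<⇒≱ short (unique-⊆⇒length-≤ unique (All.lookup all)))
... | no ¬all = find (¬All⇒Any¬ (_∈? ys) S ¬all)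

-- A further member of `S` would extend `ys` to more distinct members than `S` has entries.
exhausted : ∀ {S ys : List ℤ} → Unique ys → (∀ {y} → y ∈ ys → y ∈ S) → length S ℕ.≤ length ys → ∀ {w} → w ∈ S → w ∈ ys
exhausted {S} {ys} unique sub short {w} w∈S with w ∈? ys
... | yes w∈ys = w∈ys
... | no w∉ys = ⊥-elim (ℕₚ.<⇒≱ (unique-⊆⇒length-≤ (¬Any⇒All¬ ys w∉ys ∷ unique) sub′) short)
  where
  sub′ : ∀ {y} → y ∈ w ∷ ys → y ∈ S
  sub′ (here refl) = w∈S
  sub′ (there y∈ys) = sub y∈ys

smaller-member : ∀ {x S} → x ∈ S → ¬ IsMinOf x S → ∃ λ l → l ∈ S × l ℤ.< x
smaller-member {x} {S} x∈S ¬min with any? (ℤ._<? x) S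
... | yes some = find some
... | no none = ⊥-elim (¬min (x∈S , λ s s∈S → ℤₚ.≮⇒≥ (All.lookup (¬Any⇒All¬ S none) s∈S)))

larger-member : ∀ {x S} → x ∈ S → ¬ IsMaxOf x S → ∃ λ r → r ∈ S × x ℤ.< r
larger-member {x} {S} x∈S ¬max with any? (x ℤ.<?_) S
... | yes some = find some
... | no none = ⊥-elim (¬max (x∈S , λ s s∈S → ℤₚ.≮⇒≥ (All.lookup (¬Any⇒All¬ S none) s∈S)))

lower-bound : ∀ S → ∃ λ m → ∀ s → s ∈ S → m ℤ.≤ s
lower-bound [] = ℤ.0ℤ , λ s ()
lower-bound (x ∷ S) with lower-bound S
... | m , below = x ℤ.⊓ m , λ where
  s (here refl) → ℤₚ.i⊓j≤i x m
  s (there s∈S) → ℤₚ.≤-trans (ℤₚ.i⊓j≤j x m) (below s s∈S)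

upper-bound : (f : ℤ → ℕ) → ∀ S → ∃ λ T → ∀ s → s ∈ S → f s ℕ.≤ T
upper-bound f [] = 0 , λ s ()
upper-bound f (x ∷ S) with upper-bound f S
... | T , above = f x ℕ.+ T , λ where
  s (here refl) → ℕₚ.m≤m+n (f s) T
  s (there s∈S) → ℕₚ.≤-trans (above s s∈S) (ℕₚ.m≤n+m T (f x))

offset : ℤ → ℤ → ℕ
offset m s = ℤ.∣ s ℤ.- m ∣

offset-self : ∀ m → offset m m ≡ 0
offset-self m = cong ℤ.∣_∣ (ℤₚ.+-inverseʳ m)

offset-mono-< : ∀ {m s t} → m ℤ.≤ s → s ℤ.< t → offset m s ℕ.< offset m t
offset-mono-< {m} {s} {t} m≤s s<t = ℤₚ.drop‿+<+ (subst₂ ℤ._<_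
  (sym (ℤₚ.0≤i⇒+∣i∣≡i (ℤₚ.i≤j⇒0≤j-i m≤s)))
  (sym (ℤₚ.0≤i⇒+∣i∣≡i (ℤₚ.i≤j⇒0≤j-i (ℤₚ.≤-trans m≤s (ℤₚ.<⇒≤ s<t)))))
  (ℤₚ.+-monoˡ-< (ℤ.- m) s<t))

offset-positive : ∀ {m s} → m ℤ.< s → 1 ℕ.≤ offset m s
offset-positive {m} {s} m<s = subst (ℕ._< offset m s) (offset-self m) (offset-mono-< ℤₚ.≤-refl m<s)

-- Implications between the three conditions

module _ (R : CompleteOrderedField) where
  open CompleteOrderedField R
  open OrderedField R

  -- The copy has ratio `suc d` and sends the lower bound `m` to `a`. If the image of `s₀` had
  -- another colour the copy would be almost monochromatic, `s₁` witnessing that two colours occur.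
  copy-closed : ∀ {S s₀ k} (χ : ℕ → Fin k) → s₀ ∈ S → ¬ HasAMCopyℕ R χ S s₀ →
    ∀ {s₁} → s₁ ∈ S → s₁ ≢ s₀ → ∀ {m} → (∀ s → s ∈ S → m ℤ.≤ s) → ∀ a d {c} →
    (∀ s → s ∈ S → s ≢ s₀ → χ (a ℕ.+ offset m s ℕ.* suc d) ≡ c) → χ (a ℕ.+ offset m s₀ ℕ.* suc d) ≡ c
  copy-closed {s₀ = s₀} χ s₀∈S none {s₁} s₁∈S s₁≢s₀ {m} below a d {c} mono =
    decidable-stable (_ Finₚ.≟ _) λ differ → none
      (ι a + - (ι (suc d) * z) , ι (suc d) , 0<ι-suc d , (λ s → a ℕ.+ offset m s ℕ.* suc d) , on-copy ,
       (λ s s′ s∈S s′∈S s≢ s′≢ → trans (mono s s∈S s≢) (sym (mono s′ s′∈S s′≢))) ,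
       λ all → differ (trans (all s₀ s₁ s₀∈S s₁∈S) (mono s₁ s₁∈S s₁≢s₀)))
    where
    z = fromℤ R m
    on-copy : ∀ s → s ∈ _ → ι (a ℕ.+ offset m s ℕ.* suc d) ≡ ι a + - (ι (suc d) * z) + ι (suc d) * fromℤ R s
    on-copy s s∈S = sym (trans (cong (λ w → ι a + - (δ * z) + δ * w) (fromℤ-∣-∣ (below s s∈S)))
      (trans (solve 5 (λ a n δ z o → a :+ n :+ δ :* (z :+ o) := a :+ o :* δ :+ (n :+ δ :* z)) refl (ι a) (- (δ * z)) δ z (ι o))
        (trans (cong (ι a + ι o * δ +_) (-‿inverseˡ (δ * z))) (trans (+-identityʳ _)
          (trans (cong (ι a +_) (sym (ι-* o (suc d)))) (sym (ι-+ a _)))))))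
      where
      δ = ι (suc d)
      o = offset m s

  -- Measured from a lower bound of `S`, the other points fall among the `offset m s₀` terms that
  -- precede the image of `s₀`.
  ¬maximum : ∀ {S s₀} → Unique S → 3 ℕ.≤ length S → Cond-i R S s₀ → ¬ IsMaxOf s₀ S
  ¬maximum {S} {s₀} unique long (k , χ , free , none) (s₀∈S , max)
    with member-outside unique (s₀ ∷ []) (ℕₚ.<⇒≤ long) | lower-bound S
  ... | s₁ , s₁∈S , s₁∉ | m , below = right-closed⇒⊥ (offset m s₀) free λ a d c mono →
    copy-closed χ s₀∈S none s₁∈S (s₁∉ ∘ here) below a d λ s s∈S s≢s₀ →
      mono (offset m s) (offset-mono-< (below s s∈S) (ℤₚ.≤∧≢⇒< (max s s∈S) s≢s₀))

  ¬minimum : ∀ {S s₀} → Unique S → 3 ℕ.≤ length S → Cond-i R S s₀ → ¬ IsMinOf s₀ S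
  ¬minimum {S} {s₀} unique long (k , χ , free , none) (s₀∈S , min)
    with member-outside unique (s₀ ∷ []) (ℕₚ.<⇒≤ long) | upper-bound (offset s₀) S
  ... | s₁ , s₁∈S , s₁∉ | T , above = left-closed⇒⊥ T free λ a d c mono →
    trans (cong χ (sym (trans (cong (λ o → a ℕ.+ o ℕ.* suc d) (offset-self s₀)) (ℕₚ.+-identityʳ a))))
      (copy-closed χ s₀∈S none s₁∈S (s₁∉ ∘ here) min a d λ s s∈S s≢s₀ →
        mono (offset s₀ s) (offset-positive (ℤₚ.≤∧≢⇒< (min s s∈S) (s≢s₀ ∘ sym))) (above s s∈S))

  -- Here `S` is exactly `l`, `s₀`, `r`, so the absence of an almost-monochromatic copy is weighted
  -- convexity for the two gaps.
  ¬triple : ∀ {S s₀ l r} → s₀ ∈ S → l ∈ S → r ∈ S → l ℤ.< s₀ → s₀ ℤ.< r → length S ℕ.≤ 3 → ¬ Cond-i R S s₀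
  ¬triple {S} {s₀} {l} {r} s₀∈S l∈S r∈S l<s₀ s₀<r short (k , χ , free , none) =
    convex⇒⊥ k χ p q (offset-positive l<s₀) (ℕₚ.m<n⇒0<n∸m p<o) free λ x d eq →
      copy-closed χ s₀∈S none l∈S (ℤₚ.<⇒≢ l<s₀) below x d λ s s∈S s≢s₀ →
        outer x d eq (members s∈S) s≢s₀
    where
    l<r = ℤₚ.<-trans l<s₀ s₀<r
    p = offset l s₀
    p<o : p ℕ.< offset l r
    p<o = offset-mono-< (ℤₚ.<⇒≤ l<s₀) s₀<r
    q = offset l r ℕ.∸ p
    members : ∀ {w} → w ∈ S → w ∈ l ∷ s₀ ∷ r ∷ []
    members = exhausted
      ((ℤₚ.<⇒≢ l<s₀ ∷ ℤₚ.<⇒≢ l<r ∷ []) ∷ (ℤₚ.<⇒≢ s₀<r ∷ []) ∷ [] ∷ [])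
      (λ { (here refl) → l∈S ; (there (here refl)) → s₀∈S ; (there (there (here refl))) → r∈S })
      short
    below : ∀ s → s ∈ S → l ℤ.≤ s
    below s s∈S with members s∈S
    ... | here refl = ℤₚ.≤-refl
    ... | there (here refl) = ℤₚ.<⇒≤ l<s₀
    ... | there (there (here refl)) = ℤₚ.<⇒≤ l<r
    outer : ∀ x d → χ (x ℕ.+ (p ℕ.+ q) ℕ.* suc d) ≡ χ x → ∀ {s} → s ∈ l ∷ s₀ ∷ r ∷ [] → s ≢ s₀ →
      χ (x ℕ.+ offset l s ℕ.* suc d) ≡ χ x
    outer x d eq (here refl) _ = cong χ (trans (cong (λ o → x ℕ.+ o ℕ.* suc d) (offset-self l)) (ℕₚ.+-identityʳ x))
    outer x d eq (there (here refl)) s≢s₀ = ⊥-elim (s≢s₀ refl)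
    outer x d eq (there (there (here refl))) _ =
      trans (cong (λ o → χ (x ℕ.+ o ℕ.* suc d)) (sym (ℕₚ.m+[n∸m]≡n (ℕₚ.<⇒≤ p<o)))) eq

  i⇒iii : ∀ {S s₀} → Unique S → 3 ℕ.≤ length S → s₀ ∈ S → Cond-i R S s₀ → Cond-iii S s₀
  i⇒iii {S} unique long s₀∈S i = ℕₚ.≰⇒> notThree , ¬minimum unique long i , ¬maximum unique long i
    where
    notThree : ¬ length S ℕ.≤ 3
    notThree short =
      let l , l∈S , l<s₀ = smaller-member s₀∈S (¬minimum unique long i)
          r , r∈S , s₀<r = larger-member s₀∈S (¬maximum unique long i)
      in ¬triple s₀∈S l∈S r∈S l<s₀ s₀<r short i

  ii⇒i : ∀ {S s₀} → Cond-ii R S s₀ → Cond-i R S s₀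
  ii⇒i (k , χ , free , none) = k , χ ∘ ι , freeℕ , noneℕ
    where
    freeℕ : APFreeℕ (χ ∘ ι)
    freeℕ (a , zero , t≢0 , _) = t≢0 refl
    freeℕ (a , suc t , _ , same) = free (ι a , ι (suc t) , (λ eq → <-irrefl (sym eq) (0<ι-suc t)) , λ m →
      trans (cong χ (sym (trans (ι-+ a _) (cong (ι a +_) (ι-* m (suc t)))))) (same m))
    noneℕ : ¬ HasAMCopyℕ R (χ ∘ ι) _ _
    noneℕ (c , δ , 0<δ , f , on-copy , mono , ¬all) = none (c , δ , 0<δ ,
      (λ s s′ s∈ s′∈ s≢ s′≢ → trans (sym (move s∈)) (trans (mono s s′ s∈ s′∈ s≢ s′≢) (move s′∈))) ,
      λ all → ¬all λ s s′ s∈ s′∈ → trans (move s∈) (trans (all s s′ s∈ s′∈) (sym (move s′∈))))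
      where
      move : ∀ {s} → s ∈ _ → χ (ι (f s)) ≡ χ (c + δ * fromℤ R s)
      move {s} s∈S = cong χ (on-copy s s∈S)

  -- Four members of `S` suffice for (ii)

  module Quadruple {z₁ z₂ z₃ z₄ : ℤ} (1<2 : z₁ ℤ.< z₂) (2<3 : z₂ ℤ.< z₃) (3<4 : z₃ ℤ.< z₄) where
    1<4 = ℤₚ.<-trans 1<2 (ℤₚ.<-trans 2<3 3<4)
    -- Gaps between distinct integers are at least 1, so the spread of a copy of the four points is
    -- `M` times a lower bound for its gaps.
    M = offset z₁ z₄

    open Colouring R M (M ℕ.+ M) ((M ℕ.+ M) ℕ.* M) (offset-positive 1<4) refl refl

    spaced : ∀ c {δ} → 0# < δ →
      Spaced δ (c + δ * fromℤ R z₁) (c + δ * fromℤ R z₂) (c + δ * fromℤ R z₃) (c + δ * fromℤ R z₄)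
    spaced c {δ} 0<δ = record
      { 0<δ = 0<δ ; gap₁ = gap 1<2 ; gap₂ = gap 2<3 ; gap₃ = gap 3<4
      ; spread = inj₂ (shift (ℤₚ.<⇒≤ 1<4)) }
      where
      shift : ∀ {z w} → z ℤ.≤ w → c + δ * fromℤ R w ≡ c + δ * fromℤ R z + ι (offset z w) * δ
      shift {z} {w} z≤w = trans (cong (λ x → c + δ * x) (fromℤ-∣-∣ z≤w))
        (solve 4 (λ c δ z o → c :+ δ :* (z :+ o) := c :+ δ :* z :+ o :* δ) refl c δ (fromℤ R z) (ι (offset z w)))
      gap : ∀ {z w} → z ℤ.< w → c + δ * fromℤ R z + δ ≤ c + δ * fromℤ R w
      gap {z} {w} z<w = subst (c + δ * fromℤ R z + δ ≤_) (sym (shift (ℤₚ.<⇒≤ z<w)))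
        (+-monoʳ-≤ _ (subst (_≤ ι (offset z w) * δ) (*-identityˡ δ) (*-monoʳ-≤ δ 0<δ (1≤ι (offset-positive z<w)))))

    -- All members other than `s₀` already agree with `z₄`, so the colour of `s₀` alone decides;
    -- this disposes of any members beyond the four.
    finish : ∀ {S s₀ c δ} → z₄ ∈ S → z₄ ≢ s₀ →
      (∀ s s' → s ∈ S → s' ∈ S → s ≢ s₀ → s' ≢ s₀ → colouring (c + δ * fromℤ R s) ≡ colouring (c + δ * fromℤ R s')) →
      colouring (c + δ * fromℤ R s₀) ≡ colouring (c + δ * fromℤ R z₄) →
      ∀ s s' → s ∈ S → s' ∈ S → colouring (c + δ * fromℤ R s) ≡ colouring (c + δ * fromℤ R s')
    finish {S} {s₀} {c} {δ} z₄∈S z₄≢s₀ mono eq s s′ s∈S s′∈S = trans (to-z₄ s s∈S) (sym (to-z₄ s′ s′∈S))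
      where
      to-z₄ : ∀ s → s ∈ S → colouring (c + δ * fromℤ R s) ≡ colouring (c + δ * fromℤ R z₄)
      to-z₄ s s∈S with s ℤ.≟ s₀
      ... | yes refl = eq
      ... | no s≢s₀ = mono s z₄ s∈S z₄∈S s≢s₀ z₄≢s₀

    ii-third : ∀ {S} → z₁ ∈ S → z₂ ∈ S → z₄ ∈ S → Cond-ii R S z₃
    ii-third z₁∈S z₂∈S z₄∈S = _ , colouring , colouring-apFree , λ (c , δ , 0<δ , mono , ¬all) →
      ¬all (finish z₄∈S 4≢3 mono (colouring-third (spaced c 0<δ)
        (mono z₁ z₄ z₁∈S z₄∈S (ℤₚ.<⇒≢ (ℤₚ.<-trans 1<2 2<3)) 4≢3)
        (mono z₂ z₄ z₂∈S z₄∈S (ℤₚ.<⇒≢ 2<3) 4≢3)))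
      where
      4≢3 : z₄ ≢ z₃
      4≢3 = ℤₚ.<⇒≢ 3<4 ∘ sym

    ii-second : ∀ {S} → z₁ ∈ S → z₃ ∈ S → z₄ ∈ S → Cond-ii R S z₂
    ii-second z₁∈S z₃∈S z₄∈S = _ , colouring , colouring-apFree , λ (c , δ , 0<δ , mono , ¬all) →
      ¬all (finish z₄∈S 4≢2 mono (colouring-second (spaced c 0<δ)
        (mono z₁ z₄ z₁∈S z₄∈S (ℤₚ.<⇒≢ 1<2) 4≢2)
        (mono z₃ z₄ z₃∈S z₄∈S (ℤₚ.<⇒≢ 2<3 ∘ sym) 4≢2)))
      where
      4≢2 : z₄ ≢ z₂
      4≢2 = ℤₚ.<⇒≢ (ℤₚ.<-trans 2<3 3<4) ∘ sym

  open Quadruple using (ii-second; ii-third)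

  -- Besides `l` and `r` on either side of `s₀` there is a fourth member `w`. If it lies to the
  -- left, `s₀` is third of the four; if to the right, second.
  iii⇒ii : ∀ {S s₀} → Unique S → s₀ ∈ S → Cond-iii S s₀ → Cond-ii R S s₀
  iii⇒ii {S} {s₀} unique s₀∈S (long , ¬min , ¬max)
    with smaller-member s₀∈S ¬min | larger-member s₀∈S ¬max
  ... | l , l∈S , l<s₀ | r , r∈S , s₀<r with member-outside unique (l ∷ s₀ ∷ r ∷ []) long
  ...   | w , w∈S , w∉ with ℤₚ.<-cmp w s₀
  ...     | tri≈ _ w≡s₀ _ = ⊥-elim (w∉ (there (here w≡s₀)))
  ...     | tri< w<s₀ _ _ with ℤₚ.<-cmp w l
  ...       | tri< w<l _ _ = ii-third w<l l<s₀ s₀<r w∈S l∈S r∈S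
  ...       | tri≈ _ w≡l _ = ⊥-elim (w∉ (here w≡l))
  ...       | tri> _ _ l<w = ii-third l<w w<s₀ s₀<r l∈S w∈S r∈S
  iii⇒ii {S} {s₀} unique s₀∈S (long , ¬min , ¬max)
    | l , l∈S , l<s₀ | r , r∈S , s₀<r | w , w∈S , w∉ | tri> _ _ s₀<w with ℤₚ.<-cmp w r
  ...       | tri< w<r _ _ = ii-second l<s₀ s₀<w w<r l∈S w∈S r∈S
  ...       | tri≈ _ w≡r _ = ⊥-elim (w∉ (there (there (here w≡r))))
  ...       | tri> _ _ r<w = ii-second l<s₀ s₀<r r<w l∈S r∈S w∈S

open import Data.Nat using (_≤_)

theorem2p1 : (R : CompleteOrderedField) (S : List ℤ) (s₀ : ℤ) →
    Unique S → 3 ≤ length S → s₀ ∈ S →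
    (Cond-i R S s₀ ⇔ Cond-ii R S s₀) × (Cond-ii R S s₀ ⇔ Cond-iii S s₀)
theorem2p1 R S s₀ unique long s₀∈S =
  mk⇔ (iii⇒ii R unique s₀∈S ∘ i⇒iii R unique long s₀∈S) (ii⇒i R) ,
  mk⇔ (i⇒iii R unique long s₀∈S ∘ ii⇒i R) (iii⇒ii R unique s₀∈S)
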